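{- Let $D$ be the degree sequence of a tree and let $r$ be a positive integer. Then the greedy tree $\mathcal G(D)$ attains the minimum of the Steiner $r$-Wiener index among all trees with degree sequence $D$: for every tree $T$ with degree sequence $D$, $\mathrm{SW}_r(T)\ge \mathrm{SW}_r(\mathcal G(D))$.
   Context: For a tree $T$ and a set $\{v_1,\dots,v_r\}$ of $r$ vertices, the Steiner distance $\mathrm{sd}(v_1,\dots,v_r)$ is the number of edges of the smallest subtree of $T$ containing $v_1,\dots,v_r$. The Steiner $r$-Wiener index is $\mathrm{SW}_r(T)=\sum_{\{v_1,\dots,v_r\}\subseteq V(T)}\mathrm{sd}(v_1,\dots,v_r)$, the sum being over all $r$-element subsets of $V(T)$. Degree sequences are written in non-increasing order. Greedy tree $\mathcal G(D)$: start with a root $v$ that is assigned the largest degree in $D$. Give $v$ its neighbours $v_1,\dots,v_{d(v)}$ and assign to them the largest available degrees with $d(v_1)\ge d(v_2)\ge\cdots$. Then give $v_1$ its remaining neighbours and assign to them the largest available degrees in non-increasing order; then do the same for $v_2$, $v_3$, etc. Continue in this way, always continuing with the labelled vertex of largest degree whose neighbours are not yet labelled (equivalently, process vertices in breadth-first order, in the order in which they were labelled, always assigning the largest remaining degrees). -}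

module Defs where

open import Data.Bool.Base using (_∨_)
open import Data.Fin.Base as Fin using (Fin; toℕ)
import Data.Fin.Properties as Fin
open import Data.Fin.Subset using (Subset; Nonempty; ∣_∣; _∈_; _⊆_; inside; outside; ⊤)
open import Data.Fin.Subset.Properties using (_∈?_; _⊆?_; nonempty?; ∈⊤)
open import Data.List.Base as List
  using (List; []; _∷_; _++_; [_]; length; map; filter; allFin; cartesianProduct; cartesianProductWith)
open import Data.List.Extrema.Nat using (min; argmin-sel; min≤xs)
open import Data.List.Membership.Propositional as L using ()
open import Data.List.Membership.Propositional.Properties
  using (∈-cartesianProductWith⁺; ∈-cartesianProduct⁺; ∈-filter⁺; ∈-filter⁻; ∈-map⁺; ∈-map⁻; ∈-lookup)
open import Data.List.Relation.Binary.Permutation.Propositional using (_↭_)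
open import Data.List.Relation.Unary.All as All using (All)
open import Data.List.Relation.Unary.AllPairs using (_∷_)
open import Data.List.Relation.Unary.Any using (here; there)
open import Data.List.Relation.Unary.Linked using (Linked; linked?)
open import Data.List.Relation.Unary.Unique.Propositional using (Unique)
import Data.List.Relation.Unary.Unique.DecPropositional as Unique
open import Data.Maybe.Base using (just)
open import Data.Maybe.Properties using (≡-dec)
open import Data.Nat.Base using (ℕ; zero; suc; _∸_; _≤_; _≥_; z≤n; s≤s)
open import Data.Nat.ListAction using (sum)
open import Data.Nat.Properties using (_≟_; _≤?_)
open import Data.Product.Base using (∃; ∃₂; ∃-syntax; _×_; _,_; proj₂)
open import Data.Product.Properties using () renaming (≡-dec to ×-≡-dec)
open import Data.Sum.Base using (inj₁; inj₂)
open import Data.Vec.Base as Vec using (Vec; []; _∷_; tabulate; lookup)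
open import Function.Base using (_∘_)
open import Relation.Binary.PropositionalEquality using (_≡_; refl; sym; cong; subst)
open import Relation.Nullary using (¬_; Dec; yes; no; does; contradiction; ¬?; map′; _×-dec_; _⊎-dec_; _→-dec_)
open import Relation.Unary using (Decidable)

private
  variable
    n : ℕ

------------------------------------------------------------------------
-- Graphs

-- Row u lists the out-neighbours of u.  A simple graph is a symmetric
-- loopless digraph; symmetry and looplessness are demanded by IsTreeOn.
Digraph : ℕ → Set
Digraph n = Vec (Subset n) n

Adj : Digraph n → Fin n → Fin n → Set
Adj G u v = v ∈ lookup G u

degree : Digraph n → Fin n → ℕ
degree G u = ∣ lookup G u ∣

adj? : (G : Digraph n) → ∀ u v → Dec (Adj G u v)
adj? G u v = v ∈? lookup G u

-- For a symmetric loopless G, each edge is counted once, at its ordered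
-- pair of endpoints u < v.
edgeCount : Digraph n → ℕ
edgeCount {n} G = length
  (filter (λ (u , v) → (u Fin.<? v) ×-dec adj? G u v) (cartesianProduct (allFin n) (allFin n)))

IsPath : Digraph n → Fin n → Fin n → List (Fin n) → Set
IsPath G u v xs =
  List.head xs ≡ just u × List.last xs ≡ just v × Linked (Adj G) xs × Unique xs

IsCycle : Digraph n → List (Fin n) → Set
IsCycle G xs = ∃₂ λ u v → IsPath G u v xs × 3 ≤ length xs × Adj G v u

-- The graph with vertex set W and the edges of G is a tree.
record IsTreeOn (W : Subset n) (G : Digraph n) : Set where
  constructor mkIsTreeOn
  field
    symmetric : ∀ u v → Adj G u v → Adj G v u
    loopless  : ∀ u → ¬ Adj G u u
    incident  : ∀ u v → Adj G u v → u ∈ W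
    nonempty  : Nonempty W
    connected : ∀ u v → u ∈ W → v ∈ W → ∃ (IsPath G u v)
    acyclic   : ¬ ∃ (IsCycle G)

IsTree : Digraph n → Set
IsTree = IsTreeOn ⊤

IsSubtree : Digraph n → Subset n → Digraph n → Set
IsSubtree T W F = IsTreeOn W F × (∀ u v → Adj F u v → Adj T u v)

------------------------------------------------------------------------
-- Degree sequences

HasDegreeSequence : Digraph n → List ℕ → Set
HasDegreeSequence {n} G D = Linked _≥_ D × map (degree G) (allFin n) ↭ D

IsTreeDegreeSequence : List ℕ → Set
IsTreeDegreeSequence D = ∃[ n ] ∃[ T ] IsTree {n} T × HasDegreeSequence T D

------------------------------------------------------------------------
-- Decidability, by exhaustive search

private
  lookup-injective : ∀ {A : Set} {xs : List A} → Unique xs →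
                     ∀ i j → List.lookup xs i ≡ List.lookup xs j → i ≡ j
  lookup-injective (x∉ ∷ p) Fin.zero    Fin.zero    eq = refl
  lookup-injective (x∉ ∷ p) Fin.zero    (Fin.suc j) eq =
    contradiction eq (All.lookup x∉ (∈-lookup j))
  lookup-injective (x∉ ∷ p) (Fin.suc i) Fin.zero    eq =
    contradiction (sym eq) (All.lookup x∉ (∈-lookup i))
  lookup-injective (x∉ ∷ p) (Fin.suc i) (Fin.suc j) eq =
    cong Fin.suc (lookup-injective p i j eq)

  unique⇒length≤ : {xs : List (Fin n)} → Unique xs → length xs ≤ n
  unique⇒length≤ p = Fin.injective⇒≤ (lookup-injective p _ _)

  anyList? : ∀ k {P : List (Fin n) → Set} → Decidable P →
             Dec (∃[ xs ] length xs ≤ k × P xs)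
  anyList? zero P? = map′
    (λ p → [] , z≤n , p) (λ where ([] , _ , p) → p) (P? [])
  anyList? (suc k) P? = map′
    (λ where
      (inj₁ p)                → [] , z≤n , p
      (inj₂ (x , xs , l , p)) → x ∷ xs , s≤s l , p)
    (λ where
      ([]     , _     , p) → inj₁ p
      (x ∷ xs , s≤s l , p) → inj₂ (x , xs , l , p))
    (P? [] ⊎-dec Fin.any? (λ x → anyList? k (P? ∘ (x ∷_))))

  anyUnique? : {P : List (Fin n) → Set} → (∀ {xs} → P xs → Unique xs) →
               Decidable P → Dec (∃ P)
  anyUnique? {n} P⇒U P? = map′
    (λ (xs , _ , p) → xs , p)
    (λ (xs , p) → xs , unique⇒length≤ (P⇒U p) , p)
    (anyList? n P?)

isPath? : (G : Digraph n) → ∀ u v → Decidable (IsPath G u v)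
isPath? G u v xs =
  ≡-dec Fin._≟_ (List.head xs) (just u) ×-dec
  ≡-dec Fin._≟_ (List.last xs) (just v) ×-dec
  linked? (adj? G) xs ×-dec
  Unique.unique? Fin._≟_ xs

isCycle? : (G : Digraph n) → Decidable (IsCycle G)
isCycle? G xs = Fin.any? λ u → Fin.any? λ v →
  isPath? G u v xs ×-dec (3 ≤? length xs) ×-dec adj? G v u

isTreeOn? : (W : Subset n) (G : Digraph n) → Dec (IsTreeOn W G)
isTreeOn? W G = map′
  (λ (a , b , c , d , e , f) → mkIsTreeOn a b c d e f)
  (λ t → let open IsTreeOn t in
         symmetric , loopless , incident , nonempty , connected , acyclic)
  ( (Fin.all? λ u → Fin.all? λ v → adj? G u v →-dec adj? G v u)
  ×-dec (Fin.all? λ u → ¬? (adj? G u u))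
  ×-dec (Fin.all? λ u → Fin.all? λ v → adj? G u v →-dec (u ∈? W))
  ×-dec nonempty? W
  ×-dec (Fin.all? λ u → Fin.all? λ v → (u ∈? W) →-dec ((v ∈? W) →-dec
           anyUnique? (λ (_ , _ , _ , p) → p) (isPath? G u v)))
  ×-dec ¬? (anyUnique? (λ (_ , _ , (_ , _ , _ , p) , _) → p) (isCycle? G)))

isSubtree? : (T : Digraph n) (W : Subset n) (F : Digraph n) → Dec (IsSubtree T W F)
isSubtree? T W F = isTreeOn? W F ×-dec
  (Fin.all? λ u → Fin.all? λ v → adj? F u v →-dec adj? T u v)

------------------------------------------------------------------------
-- Steiner distance and the Steiner Wiener index

vectors : {A : Set} → List A → (m : ℕ) → List (Vec A m)
vectors as zero    = [ [] ]
vectors as (suc m) = cartesianProductWith _∷_ as (vectors as m)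

subsets : (n : ℕ) → List (Subset n)
subsets = vectors (inside ∷ outside ∷ [])

digraphs : (n : ℕ) → List (Digraph n)
digraphs n = vectors (subsets n) n

subtreesContaining : Digraph n → Subset n → List (Subset n × Digraph n)
subtreesContaining {n} T S = filter
  (λ (W , F) → isSubtree? T W F ×-dec (S ⊆? W))
  (cartesianProduct (subsets n) (digraphs n))

-- The first argument of min is its value on the empty list.  It does not
-- affect the minimum when T is a tree, since T is then a subtree of itself
-- containing S; see steinerDistance-attained and steinerDistance-least.
steinerDistance : Digraph n → Subset n → ℕ
steinerDistance T S =
  min (edgeCount T) (map (edgeCount ∘ proj₂) (subtreesContaining T S))

steinerWiener : ℕ → Digraph n → ℕ
steinerWiener {n} r T =
  sum (map (steinerDistance T) (filter (λ S → ∣ S ∣ ≟ r) (subsets n)))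

private
  ∈-vectors : {A : Set} {as : List A} → (∀ a → a L.∈ as) →
              ∀ {m} (v : Vec A m) → v L.∈ vectors as m
  ∈-vectors all []      = here refl
  ∈-vectors all (a ∷ v) = ∈-cartesianProductWith⁺ _∷_ (all a) (∈-vectors all v)

  ∈-subsets : (S : Subset n) → S L.∈ subsets n
  ∈-subsets = ∈-vectors λ where
    inside  → here refl
    outside → there (here refl)

  ∈-digraphs : (G : Digraph n) → G L.∈ digraphs n
  ∈-digraphs = ∈-vectors ∈-subsets

steinerDistance-attained : (T : Digraph n) (S : Subset n) → IsTree T →
  ∃₂ λ W F → IsSubtree T W F × S ⊆ W × edgeCount F ≡ steinerDistance T S
steinerDistance-attained {n} T S tree
  with argmin-sel (λ k → k) (edgeCount T) (map (edgeCount ∘ proj₂) (subtreesContaining T S))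
... | inj₁ eq = ⊤ , T , (tree , λ _ _ uv → uv) , (λ _ → ∈⊤) , sym eq
... | inj₂ m with (W , F) , WF∈ , eq ← ∈-map⁻ (edgeCount ∘ proj₂) m
             with _ , sub , S⊆W ← ∈-filter⁻ (λ (W , F) → isSubtree? T W F ×-dec (S ⊆? W))
                    {xs = cartesianProduct (subsets n) (digraphs n)} WF∈
             = W , F , sub , S⊆W , sym eq

steinerDistance-least : (T : Digraph n) (S W : Subset n) (F : Digraph n) →
  IsSubtree T W F → S ⊆ W → steinerDistance T S ≤ edgeCount F
steinerDistance-least T S W F sub S⊆W = All.lookup
  (min≤xs (edgeCount T) _)
  (∈-map⁺ (edgeCount ∘ proj₂)
    (∈-filter⁺ (λ (W , F) → isSubtree? T W F ×-dec (S ⊆? W))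
      (∈-cartesianProduct⁺ (∈-subsets W) (∈-digraphs F)) (sub , S⊆W)))

------------------------------------------------------------------------
-- The greedy tree

-- Vertices are labelled 0, 1, 2, … in the order in which they receive
-- their degrees, so for non-increasing D vertex i receives the i-th entry.
-- The queue holds the labelled vertices whose neighbours are not all
-- labelled yet, each with its number of missing neighbours; k is the next
-- label and the list of naturals holds the degrees not yet assigned.  A
-- new vertex of degree d still lacks d ∸ 1 neighbours, the other one being
-- its parent.  The result lists the edges as (parent , child).
greedyEdges : List (ℕ × ℕ) → ℕ → List ℕ → List (ℕ × ℕ)
greedyEdges _                 k []         = []
greedyEdges []                k (_ ∷ _)    = []
greedyEdges ((p , zero) ∷ q)  k ds@(_ ∷ _) = greedyEdges q k ds
greedyEdges ((p , suc s) ∷ q) k (d ∷ ds)   =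
  (p , k) ∷ greedyEdges (((p , s) ∷ q) ++ [ (k , d ∸ 1) ]) (suc k) ds

greedyTreeEdges : List ℕ → List (ℕ × ℕ)
greedyTreeEdges []       = []
greedyTreeEdges (d ∷ ds) = greedyEdges [ (0 , d) ] 1 ds

greedyTree : (D : List ℕ) → Digraph (length D)
greedyTree D = tabulate λ u → tabulate λ v →
  does ((toℕ u , toℕ v) ∈E?) ∨ does ((toℕ v , toℕ u) ∈E?)
  where
  open import Data.List.Membership.DecPropositional (×-≡-dec _≟_ _≟_) renaming (_∈?_ to _∈L?_)
  _∈E? : (e : ℕ × ℕ) → Dec (e L.∈ greedyTreeEdges D)
  e ∈E? = e ∈L? greedyTreeEdges D

-- An edge contributes to the Steiner distance of S exactly when it separates
-- S, so SW_r(T) is the sum over the edges e of C(n,r) − C(x,r) − C(n−x,r),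
-- where x is the number of vertices on either side of e.  This summand is a
-- concave function of x, increasing for x ≤ n/2.  Root T at a centroid, so that all
-- proper subtrees have at most n/2 vertices.  By Abel summation it suffices
-- that the sum over all vertices v of min(size v, j) is smallest for the
-- greedy tree, for every j.  With k the number of vertices of subtree size
-- at least j, this sum is k j plus the sum of the distances from these k
-- vertices.  The number of vertices within distance t + 1 is bounded by
-- Φ of the number within distance t, where Φ m is 1 plus the m largest
-- numbers of children; in the greedy tree, starting from the first k
-- vertices, breadth-first labelling attains this bound for all t at once.
module Submission where

open import Defs
open import Data.Bool.Base using (Bool; true; false; if_then_else_)
import Data.Bool.Properties as Bool
open import Data.Empty using (⊥; ⊥-elim)
open import Data.Fin.Base using (Fin; zero; suc; toℕ; fromℕ<)
open import Data.Fin.Properties as Fin using (_≟_; ¬∀⟶∃¬)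
open import Data.Fin.Subset using (Subset; inside; outside; ∣_∣; _∈_; _⊆_; ∁; Nonempty; ⊤)
open import Data.Fin.Subset.Properties using (_∈?_; _⊆?_; ∈⊤; ⊆⊤; x∈∁p⇒x∉p; x∉∁p⇒x∈p; ∣∁p∣≡n∸∣p∣; ∣⊥∣≡0; ∣⊤∣≡n; nonempty?; Empty-unique)
open import Data.List.Base as List using (List; []; _∷_; [_]; _++_; length; map; filter; take; replicate; allFin; cartesianProduct)
import Data.List.Membership.DecPropositional as DecMembership
open import Data.List.Membership.Propositional as L using ()
open import Data.List.Properties using (map-++; map-∘; map-cong; map-id; map-tabulate; tabulate-cong; ++-assoc; ++-identityʳ; length-++; length-map; length-replicate; length-tabulate)
open import Data.List.Relation.Binary.Permutation.Propositional using (↭-reflexive)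
open import Data.List.Relation.Binary.Permutation.Propositional.Properties using (map⁺; All-resp-↭; ↭-length)
open import Data.List.Relation.Unary.All as All using (All; []; _∷_)
import Data.List.Relation.Unary.All.Properties as All
open import Data.List.Relation.Unary.AllPairs using ([]; _∷_)
open import Data.List.Relation.Unary.Any using (here; there)
open import Data.List.Relation.Unary.Linked as Linked using (Linked; []; [-]; _∷_)
open import Data.List.Relation.Unary.Unique.Propositional using (Unique)
open import Data.Maybe.Base using (just)
open import Data.Nat.Base using (ℕ; zero; suc; _+_; _*_; _∸_; _≤_; _<_; _≥_; _>_; _≤′_; ≤′-refl; ≤′-step; z≤n; s≤s; _⊓_; pred)
open import Data.Nat.ListAction using (sum)
open import Data.Nat.ListAction.Properties using (sum-++; sum-↭)
open import Data.Nat.Properties as ℕ using ()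
open import Data.Nat.Tactic.RingSolver using (solve-∀)
open import Data.Product.Base using (∃; ∃₂; ∃-syntax; _×_; _,_; proj₁; proj₂)
open import Data.Product.Properties using () renaming (≡-dec to ×-≡-dec)
open import Data.Sum.Base as Sum using (_⊎_; inj₁; inj₂; [_,_]′)
open import Data.Vec.Base using ([]; _∷_; tabulate; lookup)
open import Data.Vec.Properties using (lookup∘tabulate; []=⇒lookup; lookup⇒[]=)
open import Function.Base using (_∘_; id; flip; _$_)
open import Relation.Binary.Construct.Closure.ReflexiveTransitive as Star using (Star; ε; _◅_; _◅◅_)
open import Relation.Binary.Definitions using (tri<; tri≈; tri>)
open import Relation.Binary.PropositionalEquality hiding ([_])
open import Relation.Nullary using (¬_; Dec; yes; no; does; contradiction; ¬?; _×-dec_; _⊎-dec_; _→-dec_)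
open import Relation.Nullary.Decidable using (dec-true; dec-false; map′)

open import Algebra.Properties.Semiring.Sum ℕ.+-*-semiring using (sum-cong-≗; ∑-distrib-+; ∑-comm; *-distribˡ-sum; *-distribʳ-sum; sum-replicate-zero) renaming (sum to ∑)

-- Only `T` is rooted at a centroid. The greedy tree keeps its first vertex as root, and nothing is
-- proved about how balanced that rooting is. This works because the slopes `δ` are cut off at 0:
-- the number of unseparated sets plus the accumulated slopes is at least C(n, r) for every subtree
-- size, with equality up to n/2. A greedy subtree beyond n/2 therefore only errs in the favourable
-- direction. The truncated sizes are treated with the same asymmetry. The greedy tree may have
-- another number of subtrees of size at least j than `T`, so its upper bound is proved for every k,
-- and the k counted in `T` is inserted. Neither bound mentions the tree beyond its child counts,
-- which is why they meet. Edges are named by their lower ends, so sums run over all vertices. The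
-- root names no edge and is corrected for by equal terms in both trees. The size of the sets is
-- `suc r` throughout the argument, and subtractions are avoided by moving terms across
-- inequalities.

variable
  n : ℕ
  P Q : Set

-- Indicators and finite sums

ind : Dec P → ℕ
ind d = if does d then 1 else 0

ind-yes : (d : Dec P) → P → ind d ≡ 1
ind-yes d p = cong (if_then 1 else 0) (dec-true d p)

ind-no : (d : Dec P) → ¬ P → ind d ≡ 0
ind-no d ¬p = cong (if_then 1 else 0) (dec-false d ¬p)

ind-mono : (d : Dec P) (e : Dec Q) → (P → Q) → ind d ≤ ind e
ind-mono (yes p) e f = ℕ.≤-reflexive (sym (ind-yes e (f p)))
ind-mono (no _)  e f = z≤n

ind-cong : (d : Dec P) (e : Dec Q) → (P → Q) → (Q → P) → ind d ≡ ind e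
ind-cong d e f g = ℕ.≤-antisym (ind-mono d e f) (ind-mono e d g)

ind≤1 : (d : Dec P) → ind d ≤ 1
ind≤1 (yes _) = s≤s z≤n
ind≤1 (no _)  = z≤n

ind-× : (d : Dec P) (e : Dec Q) → ind (d ×-dec e) ≡ ind d * ind e
ind-× (yes _) e = sym (ℕ.+-identityʳ _)
ind-× (no _)  e = refl

ind-¬ : (d : Dec P) → ind d + ind (¬? d) ≡ 1
ind-¬ (yes _) = refl
ind-¬ (no _)  = refl

ind-⊎ : (d : Dec P) (e : Dec Q) → ¬ (P × Q) → ind (d ⊎-dec e) ≡ ind d + ind e
ind-⊎ (yes p) e ¬pq = cong suc (sym (ind-no e (λ q → ¬pq (p , q))))
ind-⊎ (no _)  e ¬pq = refl

∑-mono : {f g : Fin n → ℕ} → (∀ i → f i ≤ g i) → ∑ f ≤ ∑ g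
∑-mono {n = zero}  h = z≤n
∑-mono {n = suc n} h = ℕ.+-mono-≤ (h zero) (∑-mono (h ∘ suc))

∑-const : ∀ n c → ∑ {n} (λ _ → c) ≡ n * c
∑-const zero    c = refl
∑-const (suc n) c = cong (c +_) (∑-const n c)

∑-zero : {f : Fin n → ℕ} → (∀ i → f i ≡ 0) → ∑ f ≡ 0
∑-zero {n} h = trans (sum-cong-≗ h) (sum-replicate-zero n)

∑-δ : (u : Fin n) (f : Fin n → ℕ) → ∑ (λ v → ind (v ≟ u) * f v) ≡ f u
∑-δ {suc n} zero f = trans (cong₂ _+_ (ℕ.+-identityʳ (f zero)) (sum-replicate-zero n)) (ℕ.+-identityʳ _)
∑-δ (suc u) f = trans (sum-cong-≗ λ v → cong (_* f (suc v)) (ind-cong (suc v ≟ suc u) (v ≟ u) Fin.suc-injective (cong suc)))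
                      (∑-δ u (f ∘ suc))

∑-δ1 : (u : Fin n) → ∑ (λ v → ind (v ≟ u)) ≡ 1
∑-δ1 u = trans (sum-cong-≗ λ v → sym (ℕ.*-identityʳ (ind (v ≟ u)))) (∑-δ u (λ _ → 1))

term≤∑ : (f : Fin n → ℕ) (u : Fin n) → f u ≤ ∑ f
term≤∑ f zero    = ℕ.m≤m+n _ _
term≤∑ f (suc u) = ℕ.≤-trans (term≤∑ (f ∘ suc) u) (ℕ.m≤n+m _ _)

Σ< : ℕ → (ℕ → ℕ) → ℕ
Σ< zero    f = 0
Σ< (suc m) f = Σ< m f + f m

Σ<-mono : ∀ m {f g : ℕ → ℕ} → (∀ i → f i ≤ g i) → Σ< m f ≤ Σ< m g
Σ<-mono zero    h = z≤n
Σ<-mono (suc m) h = ℕ.+-mono-≤ (Σ<-mono m h) (h m)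

Σ<-cong : ∀ m {f g : ℕ → ℕ} → (∀ i → f i ≡ g i) → Σ< m f ≡ Σ< m g
Σ<-cong zero    h = refl
Σ<-cong (suc m) h = cong₂ _+_ (Σ<-cong m h) (h m)

Σ<-∑ : ∀ m (F : ℕ → Fin n → ℕ) → Σ< m (λ a → ∑ (F a)) ≡ ∑ (λ v → Σ< m (λ a → F a v))
Σ<-∑ {n} zero    F = sym (sum-replicate-zero n)
Σ<-∑ (suc m) F = trans (cong (_+ ∑ (F m)) (Σ<-∑ m F)) (sym (∑-distrib-+ _ (F m)))

Σ<-indicator : ∀ m x → Σ< m (λ a → ind (a ℕ.<? x)) ≡ x ⊓ m
Σ<-indicator zero    x = sym (ℕ.⊓-zeroʳ x)
Σ<-indicator (suc m) x with m ℕ.<? x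
... | yes m<x = trans (cong₂ _+_ (Σ<-indicator m x) (ind-yes (m ℕ.<? x) m<x)) (trans (cong (_+ 1) (ℕ.m≥n⇒m⊓n≡n (ℕ.<⇒≤ m<x)))
                 (trans (ℕ.+-comm m 1) (sym (ℕ.m≥n⇒m⊓n≡n m<x))))
... | no  m≮x = trans (cong₂ _+_ (Σ<-indicator m x) (ind-no (m ℕ.<? x) m≮x)) (trans (ℕ.+-identityʳ _)
                 (trans (ℕ.m≤n⇒m⊓n≡m (ℕ.≮⇒≥ m≮x)) (sym (ℕ.m≤n⇒m⊓n≡m (ℕ.m≤n⇒m≤1+n (ℕ.≮⇒≥ m≮x))))))

Σ<-truncate : ∀ m x (f : ℕ → ℕ) → Σ< m (λ a → f a * ind (a ℕ.<? x)) ≡ Σ< (x ⊓ m) f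
Σ<-truncate zero    x f = cong (flip Σ< f) (sym (ℕ.⊓-zeroʳ x))
Σ<-truncate (suc m) x f with m ℕ.<? x
... | yes m<x rewrite ℕ.m≥n⇒m⊓n≡n m<x =
      cong₂ _+_ (trans (Σ<-truncate m x f) (cong (flip Σ< f) (ℕ.m≥n⇒m⊓n≡n (ℕ.<⇒≤ m<x))))
        (trans (cong (f m *_) (ind-yes (m ℕ.<? x) m<x)) (ℕ.*-identityʳ (f m)))
... | no  m≮x rewrite ℕ.m≤n⇒m⊓n≡m (ℕ.m≤n⇒m≤1+n (ℕ.≮⇒≥ m≮x)) =
      trans (cong₂ _+_ (trans (Σ<-truncate m x f) (cong (flip Σ< f) (ℕ.m≤n⇒m⊓n≡m (ℕ.≮⇒≥ m≮x))))
        (trans (cong (f m *_) (ind-no (m ℕ.<? x) m≮x)) (ℕ.*-zeroʳ (f m)))) (ℕ.+-identityʳ _)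

-- A sum weighted by a non-increasing `δ` is a nonnegative combination of partial sums, with
-- coefficients `δ a ∸ δ (suc a)` and a boundary weight. The boundary term is kept on both sides in
-- `strong` and cancelled here.
abel : (δ N N′ : ℕ → ℕ) → (∀ a → δ (suc a) ≤ δ a) → ∀ m → (∀ j → j ≤ m → Σ< j N′ ≤ Σ< j N) →
       Σ< m (λ a → δ a * N′ a) ≤ Σ< m (λ a → δ a * N a)
abel δ N N′ δ↓ m dom = ℕ.+-cancelʳ-≤ (δ m * Σ< m N) _ _
  (ℕ.≤-trans (strong m dom) (ℕ.+-monoʳ-≤ _ (ℕ.*-monoʳ-≤ (δ m) (dom m ℕ.≤-refl))))
  where
  open ℕ.≤-Reasoning
  -- The accumulated surplus is at least δ m times the surplus of the unweighted sums
  strong : ∀ m → (∀ j → j ≤ m → Σ< j N′ ≤ Σ< j N) →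
    Σ< m (λ a → δ a * N′ a) + δ m * Σ< m N ≤ Σ< m (λ a → δ a * N a) + δ m * Σ< m N′
  strong zero    dom = ℕ.≤-refl
  -- `e` is the drop from `δ m` to `δ (suc m)`. Adding `e` times the partial sum restores the weight
  -- `δ m` of the induction hypothesis, and `dom (suc m)` pays for exchanging the two partial sums.
  strong (suc m) dom with e , δm≡ ← ℕ.m≤n⇒∃[o]m+o≡n (δ↓ m) = ℕ.+-cancelʳ-≤ (e * (Σ< m N + N m)) _ _ $ begin
    A′ + δ m * N′ m + δ (suc m) * (S + N m) + e * (S + N m) ≡⟨ regroup₁ A′ (δ m * N′ m) (δ (suc m)) e (S + N m) ⟩
    A′ + δ m * N′ m + (δ (suc m) + e) * (S + N m) ≡⟨ cong (λ z → A′ + δ m * N′ m + z * (S + N m)) δm≡ ⟩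
    A′ + δ m * N′ m + δ m * (S + N m) ≡⟨ regroup₂ A′ (δ m) (N′ m) S (N m) ⟩
    (A′ + δ m * S) + δ m * (N′ m + N m) ≤⟨ ℕ.+-monoˡ-≤ _ (strong m (λ j j≤m → dom j (ℕ.m≤n⇒m≤1+n j≤m))) ⟩
    (A + δ m * S′) + δ m * (N′ m + N m) ≡⟨ regroup₃ A (δ m) S′ (N′ m) (N m) ⟩
    A + δ m * N m + δ m * (S′ + N′ m) ≡⟨ cong (λ z → A + δ m * N m + z * (S′ + N′ m)) δm≡ ⟨
    A + δ m * N m + (δ (suc m) + e) * (S′ + N′ m) ≡⟨ regroup₁ A (δ m * N m) (δ (suc m)) e (S′ + N′ m) ⟨
    A + δ m * N m + δ (suc m) * (S′ + N′ m) + e * (S′ + N′ m) ≤⟨ ℕ.+-monoʳ-≤ _ (ℕ.*-monoʳ-≤ e (dom (suc m) ℕ.≤-refl)) ⟩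
    A + δ m * N m + δ (suc m) * (S′ + N′ m) + e * (S + N m) ∎
    where
    A = Σ< m (λ a → δ a * N a)
    A′ = Σ< m (λ a → δ a * N′ a)
    S = Σ< m N
    S′ = Σ< m N′
    regroup₁ : ∀ x y a b c → x + y + a * c + b * c ≡ x + y + (a + b) * c
    regroup₁ = solve-∀
    regroup₂ : ∀ a d x s y → a + d * x + d * (s + y) ≡ (a + d * s) + d * (x + y)
    regroup₂ = solve-∀
    regroup₃ : ∀ a d s x y → (a + d * s) + d * (x + y) ≡ a + d * y + d * (s + x)
    regroup₃ = solve-∀

-- Binomial coefficients

binom : ℕ → ℕ → ℕ
binom n       zero    = 1
binom zero    (suc k) = 0
binom (suc n) (suc k) = binom n k + binom n (suc k)

binom-suc-≤ : ∀ m k → binom m k ≤ binom (suc m) k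
binom-suc-≤ m zero    = ℕ.≤-refl
binom-suc-≤ m (suc k) = ℕ.m≤n+m _ _

binom-mono : ∀ {m m′} k → m ≤ m′ → binom m k ≤ binom m′ k
binom-mono {m} k m≤m′ = go (ℕ.≤⇒≤′ m≤m′)
  where
  go : ∀ {m′} → m ≤′ m′ → binom m k ≤ binom m′ k
  go ≤′-refl     = ℕ.≤-refl
  go (≤′-step l) = ℕ.≤-trans (go l) (binom-suc-≤ _ k)

-- h x is the number of (suc r)-subsets not separated by an edge with x
-- vertices on one side.  Its decrements δ are truncated to 0 beyond n / 2,
-- where h increases again.
module Cut (n r : ℕ) where

  h : ℕ → ℕ
  h x = binom x (suc r) + binom (n ∸ x) (suc r)

  δ : ℕ → ℕ
  δ a = binom (n ∸ suc a) r ∸ binom a r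

  δ-antitone : ∀ a → δ (suc a) ≤ δ a
  δ-antitone a = ℕ.∸-mono (binom-mono r (ℕ.∸-monoʳ-≤ n (ℕ.n≤1+n (suc a)))) (binom-suc-≤ a r)

  -- Pascal's rule in both binomials. The decrement of `h` is `binom (n ∸ suc x) r` minus
  -- `binom x r`, written without subtraction since it is negative beyond the middle.
  h-suc : ∀ x → x < n → h (suc x) + binom (n ∸ suc x) r ≡ h x + binom x r
  h-suc x x<n = begin
    binom x r + binom x (suc r) + binom m (suc r) + binom m r ≡⟨ regroup (binom x r) (binom x (suc r)) (binom m (suc r)) (binom m r) ⟩
    binom x (suc r) + binom (suc m) (suc r) + binom x r  ≡⟨ cong (λ k → binom x (suc r) + binom k (suc r) + binom x r) (sym (ℕ.+-∸-assoc 1 x<n)) ⟩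
    h x + binom x r ∎
    where
    open ≡-Reasoning
    m = n ∸ suc x
    regroup : ∀ a b c d → a + b + c + d ≡ b + (d + c) + a
    regroup = solve-∀

  -- Telescoping from `h 0`. Truncation can only enlarge a decrement, so an inequality survives for
  -- all sizes.
  h-lower : ∀ x → x ≤ n → binom n (suc r) ≤ h x + Σ< x δ
  h-lower zero    _   = ℕ.≤-reflexive (sym (ℕ.+-identityʳ _))
  h-lower (suc x) x<n = ℕ.≤-trans (h-lower x (ℕ.<⇒≤ x<n)) (begin
    h x + Σ< x δ ≤⟨ ℕ.+-monoˡ-≤ _ step ⟩
    h (suc x) + δ x + Σ< x δ ≡⟨ regroup (h (suc x)) (δ x) _ ⟩
    h (suc x) + (Σ< x δ + δ x) ∎)
    where
    open ℕ.≤-Reasoning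
    regroup : ∀ a b c → a + b + c ≡ a + (c + b)
    regroup = solve-∀
    step : h x ≤ h (suc x) + δ x
    step = ℕ.+-cancelʳ-≤ (binom x r) _ _ $ begin
      h x + binom x r ≡⟨ h-suc x x<n ⟨
      h (suc x) + binom (n ∸ suc x) r ≤⟨ ℕ.+-monoʳ-≤ (h (suc x)) (ℕ.m≤n+m∸n _ (binom x r)) ⟩
      h (suc x) + (binom x r + δ x) ≡⟨ cong (h (suc x) +_) (ℕ.+-comm (binom x r) _) ⟩
      h (suc x) + (δ x + binom x r) ≡⟨ ℕ.+-assoc (h (suc x)) _ _ ⟨
      h (suc x) + δ x + binom x r ∎

  -- Up to the middle `binom x r` is at most `binom (n ∸ suc x) r`, so no decrement is truncated and
  -- the telescoping is exact.
  h-exact : ∀ x → 2 * x ≤ n → h x + Σ< x δ ≡ binom n (suc r)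
  h-exact zero    _    = ℕ.+-identityʳ _
  h-exact (suc x) 2x≤n = trans (begin
    h (suc x) + (Σ< x δ + δ x) ≡⟨ regroup (h (suc x)) (δ x) _ ⟩
    h (suc x) + δ x + Σ< x δ ≡⟨ cong (_+ Σ< x δ) step ⟩
    h x + Σ< x δ ∎) (h-exact x (ℕ.≤-trans (ℕ.*-monoʳ-≤ 2 (ℕ.n≤1+n x)) 2x≤n))
    where
    open ≡-Reasoning
    regroup : ∀ a b c → a + (c + b) ≡ a + b + c
    regroup = solve-∀
    2+2x≤n : suc x + suc x ≤ n
    2+2x≤n = subst (_≤ n) (cong (suc x +_) (ℕ.+-identityʳ (suc x))) 2x≤n
    x≤ : x ≤ n ∸ suc x
    x≤ = ℕ.≤-trans (ℕ.n≤1+n x) (ℕ.m+n≤o⇒m≤o∸n (suc x) 2+2x≤n)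
    step : h (suc x) + δ x ≡ h x
    step = ℕ.+-cancelʳ-≡ (binom x r) _ _ (begin
      h (suc x) + δ x + binom x r ≡⟨ ℕ.+-assoc (h (suc x)) _ _ ⟩
      h (suc x) + (δ x + binom x r) ≡⟨ cong (h (suc x) +_) (ℕ.m∸n+n≡m (binom-mono r x≤)) ⟩
      h (suc x) + binom (n ∸ suc x) r ≡⟨ h-suc x (ℕ.m+n≤o⇒m≤o (suc x) 2+2x≤n) ⟩
      h x + binom x r ∎)

  h-n : h n ≡ binom n (suc r)
  h-n = trans (cong (λ k → binom n (suc r) + binom k (suc r)) (ℕ.n∸n≡0 n)) (ℕ.+-identityʳ _)

does-cong : (d : Dec P) (e : Dec Q) → (P → Q) → (Q → P) → does d ≡ does e
does-cong (yes p) e f g = sym (dec-true e (f p))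
does-cong (no ¬p) e f g = sym (dec-false e (¬p ∘ g))

-- Digraphs, walks and paths

fromRel : {R : Fin n → Fin n → Set} → (∀ u v → Dec (R u v)) → Digraph n
fromRel R? = tabulate λ u → tabulate λ v → does (R? u v)

∈-tabulate⁺ : {f : Fin n → Bool} {v : Fin n} → f v ≡ true → v ∈ tabulate f
∈-tabulate⁺ {f = f} {v} eq = lookup⇒[]= v (tabulate f) (trans (lookup∘tabulate f v) eq)

∈-tabulate⁻ : {f : Fin n → Bool} {v : Fin n} → v ∈ tabulate f → f v ≡ true
∈-tabulate⁻ {f = f} {v} v∈ = trans (sym (lookup∘tabulate f v)) ([]=⇒lookup v∈)

does⇒ : (d : Dec P) → does d ≡ true → P
does⇒ (yes p) _ = p

module _ {R : Fin n → Fin n → Set} (R? : ∀ u v → Dec (R u v)) where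

  fromRel⁺ : ∀ {u v} → R u v → Adj (fromRel R?) u v
  fromRel⁺ {u} {v} uv = subst (v ∈_) (sym (lookup∘tabulate _ u)) (∈-tabulate⁺ (dec-true (R? u v) uv))

  fromRel⁻ : ∀ {u v} → Adj (fromRel R?) u v → R u v
  fromRel⁻ {u} {v} uv = does⇒ (R? u v) (∈-tabulate⁻ (subst (v ∈_) (lookup∘tabulate _ u) uv))

SimplePath : (Fin n → Fin n → Set) → Fin n → Fin n → List (Fin n) → Set
SimplePath R u v xs = List.head xs ≡ just u × List.last xs ≡ just v × Linked R xs × Unique xs

module _ {n : ℕ} {R : Fin n → Fin n → Set} where

  open DecMembership (Fin._≟_ {n}) renaming (_∈?_ to _∈L?_)

  suffix : ∀ {u v xs} → u L.∈ xs → List.last xs ≡ just v → Linked R xs → Unique xs → ∃ (SimplePath R u v)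
  suffix (here refl) l lk uq = _ , refl , l , lk , uq
  suffix {xs = _ ∷ y ∷ xs} (there m) l (_ ∷ lk) (_ ∷ uq) = suffix m l lk uq

  -- Loop erasure: if the new first vertex already lies on the path, the path is cut back to that
  -- occurrence.
  walk⇒path : ∀ {u v} → Star R u v → ∃ (SimplePath R u v)
  walk⇒path {u} ε = u ∷ [] , refl , refl , [-] , [] ∷ []
  walk⇒path {u} (uw ◅ wv) with walk⇒path wv
  ... | w ∷ xs , refl , l , lk , uq with u ∈L? (w ∷ xs)
  ...   | yes u∈ = suffix u∈ l lk uq
  ...   | no  u∉ = u ∷ w ∷ xs , refl , l , uw ∷ lk , All.¬Any⇒All¬ _ u∉ ∷ uq

  linked⇒walk : ∀ {v} x xs → List.last (x ∷ xs) ≡ just v → Linked R (x ∷ xs) → Star R x v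
  linked⇒walk x []       refl [-]       = ε
  linked⇒walk x (y ∷ xs) l    (xy ∷ lk) = xy ◅ linked⇒walk y xs l lk

  path⇒walk : ∀ {u v xs} → SimplePath R u v xs → Star R u v
  path⇒walk {xs = x ∷ xs} (refl , l , lk , _) = linked⇒walk x xs l lk

-- Together with `cut-edge`, this forces every walk in the tree that enters or leaves a descendant
-- set to use the single edge above it.
walk-crossing : {R : Fin n → Fin n → Set} (χ : Fin n → Bool) {u v : Fin n} → Star R u v → χ u ≢ χ v →
  ∃₂ λ x y → R x y × χ x ≢ χ y
walk-crossing χ ε u≢v = contradiction refl u≢v
walk-crossing χ {u} (_◅_ {j = w} uw wv) u≢v with χ u Bool.≟ χ w
... | yes eq = walk-crossing χ wv (λ eq′ → u≢v (trans eq eq′))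
... | no neq = u , w , uw , neq

-- Rooted trees

-- The parent of the root is irrelevant.
record Rooting (n : ℕ) : Set where
  field
    root        : Fin n
    parent      : Fin n → Fin n
    rank        : Fin n → ℕ
    rank-parent : ∀ {v} → v ≢ root → rank (parent v) < rank v

  Child : Fin n → Fin n → Set
  Child u v = v ≢ root × parent v ≡ u

  child? : ∀ u v → Dec (Child u v)
  child? u v = ¬? (v ≟ root) ×-dec (parent v ≟ u)

  rank-rec : (P : Fin n → Set) → (∀ v → (v ≢ root → P (parent v)) → P v) → ∀ v → P v
  rank-rec P f v = go (suc (rank v)) v ℕ.≤-refl
    where
    go : ∀ k v → rank v < k → P v
    go (suc k) v (s≤s l) = f v λ v≢r → go k (parent v) (ℕ.<-≤-trans (rank-parent v≢r) l)

  infix 4 _≼_ _≼?_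

  data _≼_ (u : Fin n) : Fin n → Set where
    ≼-refl : u ≼ u
    below  : ∀ {v} → v ≢ root → u ≼ parent v → u ≼ v

  abstract
    _≼?_ : ∀ u v → Dec (u ≼ v)
    u ≼? v = rank-rec (λ v → Dec (u ≼ v)) step v
      where
      step : ∀ v → (v ≢ root → Dec (u ≼ parent v)) → Dec (u ≼ v)
      step v ih with v ≟ u
      ... | yes refl = yes ≼-refl
      ... | no v≢u with v ≟ root
      ...   | yes refl = no λ { ≼-refl → v≢u refl ; (below v≢r _) → v≢r refl }
      ...   | no v≢r = map′ (below v≢r) (λ { ≼-refl → contradiction refl v≢u ; (below _ p) → p }) (ih v≢r)

  root≼ : ∀ v → root ≼ v
  root≼ = rank-rec _ λ v ih → case v ih (v ≟ root)
    where
    case : ∀ v → (v ≢ root → root ≼ parent v) → Dec (v ≡ root) → root ≼ v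
    case v ih (yes refl) = ≼-refl
    case v ih (no v≢r)   = below v≢r (ih v≢r)

  ≼-parent : ∀ {u v} → u ≼ v → u ≢ v → u ≼ parent v
  ≼-parent ≼-refl      u≢v = contradiction refl u≢v
  ≼-parent (below _ p) _   = p

  ≼⇒rank≤ : ∀ {u v} → u ≼ v → rank u ≤ rank v
  ≼⇒rank≤ ≼-refl        = ℕ.≤-refl
  ≼⇒rank≤ (below v≢r p) = ℕ.≤-trans (≼⇒rank≤ p) (ℕ.<⇒≤ (rank-parent v≢r))

  ≺⇒rank< : ∀ {u v} → u ≼ v → u ≢ v → rank u < rank v
  ≺⇒rank< ≼-refl        u≢v = contradiction refl u≢v
  ≺⇒rank< (below v≢r p) _   = ℕ.≤-<-trans (≼⇒rank≤ p) (rank-parent v≢r)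

  ⋠parent : ∀ {v} → v ≢ root → ¬ v ≼ parent v
  ⋠parent v≢r v≼p = ℕ.<⇒≱ (rank-parent v≢r) (≼⇒rank≤ v≼p)

  ≼-trans : ∀ {u v w} → u ≼ v → v ≼ w → u ≼ w
  ≼-trans uv ≼-refl        = uv
  ≼-trans uv (below w≢r p) = below w≢r (≼-trans uv p)

  ≼-total : ∀ {u v w} → u ≼ w → v ≼ w → u ≼ v ⊎ v ≼ u
  ≼-total ≼-refl          vw              = inj₂ vw
  ≼-total uw@(below _ _)  ≼-refl          = inj₁ uw
  ≼-total (below _ uw)    (below _ vw)    = ≼-total uw vw

  ≼?-parent : ∀ {u v} → v ≢ root → v ≢ u → does (u ≼? v) ≡ does (u ≼? parent v)
  ≼?-parent v≢r v≢u = does-cong (_ ≼? _) (_ ≼? _) (λ p → ≼-parent p (v≢u ∘ sym)) (below v≢r)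

  ind-≼?-below : ∀ {u v} → v ≢ root → ind (u ≼? v) ≡ ind (u ≟ v) + ind (u ≼? parent v)
  ind-≼?-below {u} {v} v≢r with u ≟ v
  ... | yes refl = trans (ind-yes (v ≼? v) ≼-refl) (cong suc (sym (ind-no (v ≼? parent v) (⋠parent v≢r))))
  ... | no u≢v   = ind-cong (_ ≼? _) (_ ≼? _) (λ p → ≼-parent p u≢v) (below v≢r)

  ind-≼?-root : ∀ u → ind (u ≼? root) ≡ ind (u ≟ root)
  ind-≼?-root u = ind-cong (u ≼? root) (u ≟ root)
    (λ { ≼-refl → refl ; (below r≢r _) → contradiction refl r≢r }) (λ { refl → ≼-refl })

  size : Fin n → ℕ
  size u = ∑ λ v → ind (u ≼? v)

  size-antitone : ∀ {u v} → u ≼ v → size v ≤ size u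
  size-antitone uv = ∑-mono λ w → ind-mono (_ ≼? w) (_ ≼? w) (≼-trans uv)

  size-root : size root ≡ n
  size-root = trans (sum-cong-≗ λ v → ind-yes (root ≼? v) (root≼ v)) (trans (∑-const n 1) (ℕ.*-identityʳ n))

  size≤ : ∀ u → size u ≤ n
  size≤ u = ℕ.≤-trans (size-antitone (root≼ u)) (ℕ.≤-reflexive size-root)

  module _ {w : Fin n} {χ : Fin n → Bool}
           (const : ∀ {v} → v ≢ root → v ≢ w → χ v ≡ χ (parent v)) where

    -- Applied with `χ` the descendant indicator of the same edge in another rooting: both rootings
    -- then divide the vertices into the same two sides.
    cut-below : ∀ {x} → w ≼ x → χ x ≡ χ w
    cut-below ≼-refl = refl
    cut-below {x} (below x≢r p) with x ≟ w
    ... | yes refl = refl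
    ... | no x≢w   = trans (const x≢r x≢w) (cut-below p)

    cut-above : ∀ x → ¬ w ≼ x → χ x ≡ χ root
    cut-above = rank-rec _ λ x ih → case x ih (x ≟ root)
      where
      case : ∀ x → (x ≢ root → ¬ w ≼ parent x → χ (parent x) ≡ χ root) → Dec (x ≡ root) → ¬ w ≼ x → χ x ≡ χ root
      case x ih (yes refl) _ = refl
      case x ih (no x≢r) w⋠x =
        trans (const x≢r (λ { refl → w⋠x ≼-refl })) (ih x≢r (w⋠x ∘ below x≢r))

open Rooting public

record IsRooting (G : Digraph n) (R : Rooting n) : Set where
  field
    adj⇒child : ∀ {u v} → Adj G u v → Child R u v ⊎ Child R v u
    child⇒adj : ∀ {u v} → Child R u v → Adj G u v
    adj-sym   : ∀ {u v} → Adj G u v → Adj G v u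

open IsRooting public

-- Rooting a tree at a prescribed vertex by distance

least : {P : ℕ → Set} → (∀ k → Dec (P k)) → ∀ {k} → P k → ∃[ m ] P m × (∀ {i} → P i → m ≤ i)
least P? {k} pk with P? 0
... | yes p0 = 0 , p0 , λ _ → z≤n
least P? {zero}  pk | no ¬p0 = contradiction pk ¬p0
least {P} P? {suc k} pk | no ¬p0 with least (P? ∘ suc) pk
... | m , pm , min = suc m , pm , minimal _
  where
  minimal : ∀ i → P i → suc m ≤ i
  minimal zero    p0 = contradiction p0 ¬p0
  minimal (suc i) pi = s≤s (min pi)

last-≢ : ∀ {A : Set} {x v : A} {xs} → All (x ≢_) xs → xs ≢ [] → List.last xs ≡ just v → x ≢ v
last-≢ {xs = []}         _         ne _    = contradiction refl ne
last-≢ {xs = _ ∷ []}     (x≢ ∷ _)  _  refl = x≢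
last-≢ {xs = _ ∷ _ ∷ _}  (_ ∷ all) _  l    = last-≢ all (λ ()) l

module _ {G : Digraph n} (tree : IsTree G) (c : Fin n) where

  open IsTreeOn tree

  private
    Reach : ℕ → Fin n → Set
    Reach zero    v = v ≡ c
    Reach (suc k) v = ∃ λ u → Reach k u × Adj G u v

    reach? : ∀ k v → Dec (Reach k v)
    reach? zero    v = v ≟ c
    reach? (suc k) v = Fin.any? λ u → reach? k u ×-dec adj? G u v

    extend : ∀ {k u v} → Reach k u → Star (Adj G) u v → ∃ λ m → Reach m v
    extend r ε         = _ , r
    extend r (uw ◅ wv) = extend (_ , r , uw) wv

    nearest : ∀ v → ∃[ m ] Reach m v × (∀ {i} → Reach i v → m ≤ i)
    nearest v = least (λ k → reach? k v) (proj₂ (extend {zero} refl (path⇒walk (proj₂ (connected c v ∈⊤ ∈⊤)))))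

    dist : Fin n → ℕ
    dist v = proj₁ (nearest v)

    -- The last vertex before `v` on a shortest walk from `c` is strictly nearer to `c`, so distance
    -- can serve as the rank.
    predecessor : ∀ v → ∃ λ u → v ≢ c → Adj G u v × dist u < dist v
    predecessor v with nearest v
    -- Here `v` is the root, and the returned vertex is a dummy.
    ... | zero  , v≡c , _ = v , contradiction v≡c
    ... | suc k , (u , ru , uv) , _ = u , λ _ → uv , s≤s (proj₂ (proj₂ (nearest u)) ru)

    R : Rooting n
    R = record { root = c ; parent = proj₁ ∘ predecessor ; rank = dist
               ; rank-parent = λ {v} v≢c → proj₂ (proj₂ (predecessor v) v≢c) }

    child⇒ : ∀ {u v} → Child R u v → Adj G u v
    child⇒ {v = v} (v≢c , refl) = proj₁ (proj₂ (predecessor v) v≢c)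

    TreeEdge : Fin n → Fin n → Set
    TreeEdge u v = Child R u v ⊎ Child R v u

    treeEdge⇒ : ∀ {u v} → TreeEdge u v → Adj G u v
    treeEdge⇒ (inj₁ uv) = child⇒ uv
    treeEdge⇒ (inj₂ vu) = symmetric _ _ (child⇒ vu)

    from-root : ∀ {v} → _≼_ R c v → Star TreeEdge c v
    from-root ≼-refl      = ε
    from-root (below v≢c p) = from-root p ◅◅ (inj₁ (v≢c , refl) ◅ ε)

    treeWalk : ∀ u v → Star TreeEdge u v
    treeWalk u v = Star.reverse [ inj₂ , inj₁ ]′ (from-root (root≼ R u)) ◅◅ from-root (root≼ R v)

    -- An edge uv outside the parent map closes the tree path from u to v to a cycle.
    adj⇒ : ∀ {u v} → Adj G u v → TreeEdge u v
    adj⇒ {u} {v} uv with child? R u v ⊎-dec child? R v u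
    ... | yes e = e
    ... | no ¬e with walk⇒path (treeWalk u v)
    ...   | (_ ∷ []) , refl , refl , _ = contradiction uv (loopless u)
    ...   | (_ ∷ _ ∷ []) , refl , refl , (e ∷ _) , _ = contradiction e ¬e
    ...   | xs@(_ ∷ _ ∷ _ ∷ _) , refl , l , lk , uq =
            contradiction (xs , u , v , (refl , l , Linked.map treeEdge⇒ lk , uq) , s≤s (s≤s (s≤s z≤n)) , symmetric u v uv) acyclic

  rooting : Rooting n
  rooting = R

  isRooting : IsRooting G rooting
  isRooting = record { adj⇒child = adj⇒ ; child⇒adj = child⇒ ; adj-sym = symmetric _ _ }

-- A rooted graph is a tree

linked-all : {A : Set} {P : A → Set} {R : A → A → Set} {xs : List A} → All P xs → Linked R xs →
             Linked (λ x y → R x y × P x × P y) xs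
linked-all []             []        = []
linked-all (_ ∷ [])       [-]       = [-]
linked-all (px ∷ py ∷ ps) (r ∷ lk) = (r , px , py) ∷ linked-all (py ∷ ps) lk

module _ {G : Digraph n} {R : Rooting n} (GR : IsRooting G R) where

  -- A vertex other than `w` and the root lies below `w` exactly when its parent does, so only the
  -- edge above `w` can leave the descendant set of `w`.
  cut-edge : ∀ {w x y} → Adj G x y → does (_≼?_ R w x) ≢ does (_≼?_ R w y) →
             (y ≡ w × Child R x y) ⊎ (x ≡ w × Child R y x)
  cut-edge {w} {x} {y} xy neq with adj⇒child GR xy
  ... | inj₁ c@(y≢r , refl) with y ≟ w
  ...   | yes y≡w = inj₁ (y≡w , c)
  ...   | no y≢w = contradiction (sym (≼?-parent R y≢r y≢w)) neq
  cut-edge {w} {x} {y} xy neq | inj₂ c@(x≢r , refl) with x ≟ w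
  ...   | yes x≡w = inj₂ (x≡w , c)
  ...   | no x≢w = contradiction (≼?-parent R x≢r x≢w) neq

  isRooting⇒loopless : ∀ u → ¬ Adj G u u
  isRooting⇒loopless u uu = [ irr , irr ]′ (adj⇒child GR uu)
    where
    irr : ¬ Child R u u
    irr (u≢r , eq) = ℕ.<-irrefl (cong (rank R) eq) (rank-parent R u≢r)

  child-separated : ∀ {u v} → Child R u v → does (_≼?_ R v u) ≢ does (_≼?_ R v v)
  child-separated {v = v} (v≢r , refl) eq =
    contradiction (trans (sym (dec-false (_≼?_ R v _) (⋠parent R v≢r))) (trans eq (dec-true (_≼?_ R v v) ≼-refl))) λ ()

  -- The closing edge joins a vertex to its parent and so separates the descendants of its lower end
  -- from the rest. The remaining cycle must cross that cut too, which only the same edge can do.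
  -- The step `uy` would give `y ≡ v` or a loop, and the walk from `y` to `v` avoids `u`.
  isRooting⇒acyclic : ¬ ∃ (IsCycle G)
  isRooting⇒acyclic (_ ∷ [] , _ , _ , _ , s≤s () , _)
  isRooting⇒acyclic (_ ∷ _ ∷ [] , _ , _ , _ , s≤s (s≤s ()) , _)
  isRooting⇒acyclic (u ∷ y ∷ zs@(_ ∷ _) , _ , v , (refl , l , uy ∷ lk , (u≢y ∷ u≢) ∷ y≢ ∷ _) , _ , vu) =
    [ at-v , at-u ]′ (adj⇒child GR (adj-sym GR vu))
    where
    y≢v : y ≢ v
    y≢v = last-≢ y≢ (λ ()) l
    u≢v : u ≢ v
    u≢v = last-≢ u≢ (λ ()) l
    avoids-u : Star (λ x z → Adj G x z × u ≢ x × u ≢ z) y v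
    avoids-u = linked⇒walk y zs l (linked-all (u≢y ∷ u≢) lk)
    at-u : ¬ Child R v u
    at-u e@(_ , pu≡v) with does (_≼?_ R u u) Bool.≟ does (_≼?_ R u y)
    ... | no neq with cut-edge uy neq
    ...   | inj₁ (y≡u , _)      = u≢y (sym y≡u)
    ...   | inj₂ (_ , _ , pu≡y) = y≢v (trans (sym pu≡y) pu≡v)
    at-u e | yes eq with walk-crossing (λ x → does (_≼?_ R u x)) avoids-u (λ eq′ → child-separated e (sym (trans eq eq′)))
    ... | x , z , (xz , u≢x , u≢z) , neq with cut-edge xz neq
    ...   | inj₁ (z≡u , _) = u≢z (sym z≡u)
    ...   | inj₂ (x≡u , _) = u≢x (sym x≡u)
    at-v : ¬ Child R u v
    at-v e@(_ , pv≡u) with does (_≼?_ R v u) Bool.≟ does (_≼?_ R v y)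
    ... | no neq with cut-edge uy neq
    ...   | inj₁ (y≡v , _) = y≢v y≡v
    ...   | inj₂ (u≡v , _) = u≢v u≡v
    at-v e@(_ , pv≡u) | yes eq with walk-crossing (λ x → does (_≼?_ R v x)) avoids-u (λ eq′ → child-separated e (trans eq eq′))
    ... | x , z , (xz , u≢x , u≢z) , neq with cut-edge xz neq
    ...   | inj₁ (refl , _ , pv≡x) = u≢x (trans (sym pv≡u) pv≡x)
    ...   | inj₂ (refl , _ , pv≡z) = u≢z (trans (sym pv≡u) pv≡z)

  walk-to-root : ∀ v → Star (Adj G) v (root R)
  walk-to-root v = go (root≼ R v)
    where
    go : ∀ {v} → _≼_ R (root R) v → Star (Adj G) v (root R)
    go ≼-refl        = ε
    go (below v≢r p) = adj-sym GR (child⇒adj GR (v≢r , refl)) ◅ go p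

  isRooting⇒IsTree : IsTree G
  isRooting⇒IsTree = record
    { symmetric = λ _ _ → adj-sym GR
    ; loopless  = isRooting⇒loopless
    ; incident  = λ _ _ _ → ∈⊤
    ; nonempty  = root R , ∈⊤
    ; connected = λ u v _ _ → walk⇒path (walk-to-root u ◅◅ Star.reverse (adj-sym GR) (walk-to-root v))
    ; acyclic   = isRooting⇒acyclic
    }

-- Separating edges and the Steiner Wiener index

sumOf : {A : Set} → (A → ℕ) → List A → ℕ
sumOf f xs = sum (map f xs)

module _ {A : Set} where

  length-filter : {P : A → Set} (P? : ∀ x → Dec (P x)) (xs : List A) → length (filter P? xs) ≡ sumOf (ind ∘ P?) xs
  length-filter P? [] = refl
  length-filter P? (x ∷ xs) with P? x
  ... | yes _ = cong suc (length-filter P? xs)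
  ... | no  _ = length-filter P? xs

  sumOf-filter : {P : A → Set} (P? : ∀ x → Dec (P x)) (f : A → ℕ) (xs : List A) →
                 sumOf f (filter P? xs) ≡ sumOf (λ x → ind (P? x) * f x) xs
  sumOf-filter P? f [] = refl
  sumOf-filter P? f (x ∷ xs) with P? x
  ... | yes _ = cong₂ _+_ (sym (ℕ.+-identityʳ (f x))) (sumOf-filter P? f xs)
  ... | no  _ = sumOf-filter P? f xs

  sumOf-++ : (f : A → ℕ) (xs ys : List A) → sumOf f (xs ++ ys) ≡ sumOf f xs + sumOf f ys
  sumOf-++ f xs ys = trans (cong sum (map-++ f xs ys)) (sum-++ (map f xs) (map f ys))

  sumOf-cong : {f g : A → ℕ} → (∀ x → f x ≡ g x) → ∀ xs → sumOf f xs ≡ sumOf g xs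
  sumOf-cong h xs = cong sum (map-cong h xs)

  sumOf-mono : {f g : A → ℕ} → (∀ x → f x ≤ g x) → ∀ xs → sumOf f xs ≤ sumOf g xs
  sumOf-mono h []       = z≤n
  sumOf-mono h (x ∷ xs) = ℕ.+-mono-≤ (h x) (sumOf-mono h xs)

  sumOf-+ : (f g : A → ℕ) (xs : List A) → sumOf (λ x → f x + g x) xs ≡ sumOf f xs + sumOf g xs
  sumOf-+ f g []       = refl
  sumOf-+ f g (x ∷ xs) = trans (cong (f x + g x +_) (sumOf-+ f g xs)) (swap (f x) (g x) _ _)
    where
    swap : ∀ a b c d → a + b + (c + d) ≡ a + c + (b + d)
    swap = solve-∀

  sumOf-∑ : (F : A → Fin n → ℕ) (xs : List A) → sumOf (λ x → ∑ (F x)) xs ≡ ∑ (λ v → sumOf (λ x → F x v) xs)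
  sumOf-∑ {n} F []       = sym (sum-replicate-zero n)
  sumOf-∑     F (x ∷ xs) = trans (cong (∑ (F x) +_) (sumOf-∑ F xs)) (sym (∑-distrib-+ (F x) _))

  sumOf-tabulate : (f : A → ℕ) (g : Fin n → A) → sumOf f (List.tabulate g) ≡ ∑ (f ∘ g)
  sumOf-tabulate {zero}  f g = refl
  sumOf-tabulate {suc n} f g = cong (f (g zero) +_) (sumOf-tabulate f (g ∘ suc))

sumOf-map : {A B : Set} (f : B → ℕ) (g : A → B) (xs : List A) → sumOf f (map g xs) ≡ sumOf (f ∘ g) xs
sumOf-map f g xs = cong sum (sym (map-∘ xs))

sumOf-product : {A B : Set} (f : A × B → ℕ) (xs : List A) (ys : List B) →
  sumOf f (cartesianProduct xs ys) ≡ sumOf (λ x → sumOf (λ y → f (x , y)) ys) xs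
sumOf-product f []       ys = refl
sumOf-product f (x ∷ xs) ys = trans (sumOf-++ f (map (x ,_) ys) _)
  (cong₂ _+_ (sumOf-map f (x ,_) ys) (sumOf-product f xs ys))

edgeCount-∑ : (G : Digraph n) → edgeCount G ≡ ∑ λ u → ∑ λ v → ind ((u Fin.<? v) ×-dec adj? G u v)
edgeCount-∑ {n} G = begin
  edgeCount G ≡⟨ length-filter _ (cartesianProduct (allFin n) (allFin n)) ⟩
  sumOf f (cartesianProduct (allFin n) (allFin n)) ≡⟨ sumOf-product f (allFin n) (allFin n) ⟩
  sumOf (λ u → sumOf (λ v → f (u , v)) (allFin n)) (allFin n) ≡⟨ sumOf-tabulate (λ u → sumOf (λ v → f (u , v)) (allFin n)) id ⟩
  ∑ (λ u → sumOf (λ v → f (u , v)) (allFin n)) ≡⟨ sum-cong-≗ (λ u → sumOf-tabulate (λ v → f (u , v)) id) ⟩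
  ∑ (λ u → ∑ λ v → f (u , v)) ∎
  where
  open ≡-Reasoning
  f : Fin n × Fin n → ℕ
  f (u , v) = ind ((u Fin.<? v) ×-dec adj? G u v)

module _ {T : Digraph n} {R : Rooting n} (TR : IsRooting T R) where

  child-asym : ∀ {u v} → Child R u v → ¬ Child R v u
  child-asym {v = v} (v≢r , refl) (u≢r , eq) =
    ℕ.<-asym (rank-parent R v≢r) (subst (λ z → rank R z < rank R (parent R v)) eq (rank-parent R u≢r))

  -- Each edge is counted at its lower end instead of at its ordered pair of ends.
  edgeCount-rooting : (F : Digraph n) → (∀ u v → Adj F u v → Adj F v u) → (∀ u v → Adj F u v → Adj T u v) →
    edgeCount F ≡ ∑ λ v → ind (¬? (v ≟ root R) ×-dec adj? F (parent R v) v)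
  edgeCount-rooting F symF F⊆T = begin
    edgeCount F ≡⟨ edgeCount-∑ F ⟩
    ∑ (λ u → ∑ λ v → ind ((u Fin.<? v) ×-dec adj? F u v)) ≡⟨ sum-cong-≗ (λ u → sum-cong-≗ (split u)) ⟩
    ∑ (λ u → ∑ λ v → lt u v * A u v + lt u v * A v u) ≡⟨ sum-cong-≗ (λ u → ∑-distrib-+ (λ v → lt u v * A u v) _) ⟩
    ∑ (λ u → ∑ (λ v → lt u v * A u v) + ∑ λ v → lt u v * A v u) ≡⟨ ∑-distrib-+ (λ u → ∑ λ v → lt u v * A u v) _ ⟩
    ∑ (λ u → ∑ λ v → lt u v * A u v) + ∑ (λ u → ∑ λ v → lt u v * A v u)
      ≡⟨ cong₂ _+_ (∑-comm (λ u v → lt u v * A u v)) refl ⟩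
    ∑ (λ u → ∑ λ v → lt v u * A v u) + ∑ (λ u → ∑ λ v → lt u v * A v u)
      ≡⟨ ∑-distrib-+ (λ u → ∑ λ v → lt v u * A v u) _ ⟨
    ∑ (λ u → ∑ (λ v → lt v u * A v u) + ∑ λ v → lt u v * A v u)
      ≡⟨ sum-cong-≗ (λ u → sym (∑-distrib-+ (λ v → lt v u * A v u) _)) ⟩
    ∑ (λ u → ∑ λ v → lt v u * A v u + lt u v * A v u) ≡⟨ sum-cong-≗ (λ u → sum-cong-≗ (λ v → merge v u)) ⟩
    ∑ (λ v → ∑ λ u → A u v) ≡⟨ sum-cong-≗ (λ v → trans (sum-cong-≗ (λ u → A-δ u v)) (∑-δ (parent R v) (λ _ → B v))) ⟩
    ∑ B ∎
    where
    open ≡-Reasoning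
    A lt : Fin n → Fin n → ℕ
    A u v = ind (child? R u v ×-dec adj? F u v)
    lt u v = ind (u Fin.<? v)
    B : Fin n → ℕ
    B v = ind (¬? (v ≟ root R) ×-dec adj? F (parent R v) v)
    split : ∀ u v → ind ((u Fin.<? v) ×-dec adj? F u v) ≡ lt u v * A u v + lt u v * A v u
    split u v = trans (ind-× (u Fin.<? v) (adj? F u v))
      (trans (cong (lt u v *_) (trans
        (ind-cong (adj? F u v) ((child? R u v ×-dec adj? F u v) ⊎-dec (child? R v u ×-dec adj? F v u))
          (λ uv → Sum.map (_, uv) (_, symF u v uv) (adj⇒child TR (F⊆T u v uv)))
          [ proj₂ , symF v u ∘ proj₂ ]′)
        (ind-⊎ (child? R u v ×-dec adj? F u v) (child? R v u ×-dec adj? F v u)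
          (λ ((c , _) , (c′ , _)) → child-asym c c′))))
      (ℕ.*-distribˡ-+ (lt u v) (A u v) (A v u)))
    merge : ∀ u v → lt u v * A u v + lt v u * A u v ≡ A u v
    merge u v = count-once (child? R u v ×-dec adj? F u v) (λ { (c , _) refl → child-asym c c })
      where
      ordered : ∀ u v → u ≢ v → toℕ u < toℕ v ⊎ toℕ v < toℕ u
      ordered u v u≢v with Fin.<-cmp u v
      ... | tri< l _ _ = inj₁ l
      ... | tri≈ _ e _ = contradiction e u≢v
      ... | tri> _ _ g = inj₂ g
      count-once : (d : Dec P) → (P → u ≢ v) → lt u v * ind d + lt v u * ind d ≡ ind d
      count-once (no _)  _ = cong₂ _+_ (ℕ.*-zeroʳ (lt u v)) (ℕ.*-zeroʳ (lt v u))
      count-once (yes p) u≢v = trans (cong₂ _+_ (ℕ.*-identityʳ (lt u v)) (ℕ.*-identityʳ (lt v u)))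
        (trans (sym (ind-⊎ (u Fin.<? v) (v Fin.<? u) (λ (l , g) → ℕ.<-asym l g)))
          (ind-yes ((u Fin.<? v) ⊎-dec (v Fin.<? u)) (ordered u v (u≢v p))))
    A-δ : ∀ u v → A u v ≡ ind (u ≟ parent R v) * B v
    A-δ u v = trans (ind-cong (child? R u v ×-dec adj? F u v) ((u ≟ parent R v) ×-dec (¬? (v ≟ root R) ×-dec adj? F (parent R v) v))
        (λ { ((v≢r , refl) , a) → refl , v≢r , a }) (λ { (refl , v≢r , a) → (v≢r , refl) , a }))
      (ind-× (u ≟ parent R v) (¬? (v ≟ root R) ×-dec adj? F (parent R v) v))

descendants : Rooting n → Fin n → Subset n
descendants R w = tabulate λ v → does (_≼?_ R w v)

descendants-size : (R : Rooting n) (w : Fin n) → ∣ descendants R w ∣ ≡ size R w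
descendants-size R w = go (λ v → does (_≼?_ R w v))
  where
  go : ∀ {n} (f : Fin n → Bool) → ∣ tabulate f ∣ ≡ ∑ (λ v → if f v then 1 else 0)
  go {zero}  f = refl
  go {suc n} f with f zero
  ... | true  = cong suc (go (f ∘ suc))
  ... | false = go (f ∘ suc)

-- `S` meets both sides of the cut. Two failed inclusions are used because sets inside one given
-- side are easy to count.
Split : Subset n → Subset n → Set
Split A S = ¬ S ⊆ A × ¬ S ⊆ ∁ A

split? : (A S : Subset n) → Dec (Split A S)
split? A S = ¬? (S ⊆? A) ×-dec ¬? (S ⊆? ∁ A)

¬⊆⇒ : {A S : Subset n} → ¬ S ⊆ A → ∃ λ x → x ∈ S × ¬ x ∈ A
¬⊆⇒ {n} {A} {S} S⊈A with ¬∀⟶∃¬ n (λ x → x ∈ S → x ∈ A) dec (λ f → S⊈A (f _))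
  where
  dec : ∀ x → Dec (x ∈ S → x ∈ A)
  dec x = (x ∈? S) →-dec (x ∈? A)
... | x , ¬f with x ∈? S
...   | yes x∈S = x , x∈S , λ x∈A → ¬f λ _ → x∈A
...   | no  x∉S = contradiction (λ x∈S → contradiction x∈S x∉S) ¬f

module _ {R : Rooting n} {w : Fin n} where

  ∈descendants⁺ : ∀ {v} → _≼_ R w v → v ∈ descendants R w
  ∈descendants⁺ p = ∈-tabulate⁺ (dec-true (_≼?_ R w _) p)

  ∈descendants⁻ : ∀ {v} → v ∈ descendants R w → _≼_ R w v
  ∈descendants⁻ v∈ = does⇒ (_≼?_ R w _) (∈-tabulate⁻ v∈)

  split⇒ : ∀ {S} → Split (descendants R w) S → ∃₂ λ x y → x ∈ S × y ∈ S × does (_≼?_ R w x) ≢ does (_≼?_ R w y)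
  split⇒ (⊈A , ⊈∁A) with ¬⊆⇒ ⊈A | ¬⊆⇒ ⊈∁A
  ... | x , x∈S , x∉A | y , y∈S , y∉∁A = x , y , x∈S , y∈S , λ eq →
    contradiction (trans (sym (dec-false (_≼?_ R w x) (x∉A ∘ ∈descendants⁺)))
                  (trans eq (dec-true (_≼?_ R w y) (∈descendants⁻ (x∉∁p⇒x∈p y∉∁A))))) λ ()

  ⇒split : ∀ {S x y} → x ∈ S → y ∈ S → does (_≼?_ R w x) ≢ does (_≼?_ R w y) → Split (descendants R w) S
  ⇒split {x = x} {y} x∈S y∈S neq =
    (λ ⊆A → neq (trans (dec-true (_≼?_ R w x) (∈descendants⁻ (⊆A x∈S))) (sym (dec-true (_≼?_ R w y) (∈descendants⁻ (⊆A y∈S)))))) ,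
    (λ ⊆∁A → neq (trans (dec-false (_≼?_ R w x) (x∈∁p⇒x∉p (⊆∁A x∈S) ∘ ∈descendants⁺))
                   (sym (dec-false (_≼?_ R w y) (x∈∁p⇒x∉p (⊆∁A y∈S) ∘ ∈descendants⁺)))))

-- The number of edges that separate `S`, each named by its lower end. The root adds 0, since all
-- vertices descend from it.
separating : Rooting n → Subset n → ℕ
separating R S = ∑ λ w → ind (split? (descendants R w) S)

-- A subtree containing `S` connects two members on different sides of a separating edge, so it must
-- contain that edge.
separating≤sd : {T : Digraph n} {R : Rooting n} → IsTree T → IsRooting T R → (S : Subset n) → separating R S ≤ steinerDistance T S
separating≤sd {T = T} {R} tree TR S with steinerDistance-attained T S tree
... | W , F , (treeF , F⊆T) , S⊆W , eq = begin
  separating R S ≤⟨ ∑-mono (λ w → ind-mono (split? (descendants R w) S) (¬? (w ≟ root R) ×-dec adj? F (parent R w) w) (edge∈F w)) ⟩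
  ∑ (λ v → ind (¬? (v ≟ root R) ×-dec adj? F (parent R v) v)) ≡⟨ edgeCount-rooting TR F symmetric F⊆T ⟨
  edgeCount F ≡⟨ eq ⟩
  steinerDistance T S ∎
  where
  open ℕ.≤-Reasoning
  open IsTreeOn treeF
  edge∈F : ∀ w → Split (descendants R w) S → w ≢ root R × Adj F (parent R w) w
  edge∈F w sp with split⇒ sp
  ... | x , y , x∈S , y∈S , neq
    with walk-crossing (λ v → does (_≼?_ R w v)) (path⇒walk (proj₂ (connected x y (S⊆W x∈S) (S⊆W y∈S)))) neq
  ... | a , b , ab , neq′ with cut-edge TR (F⊆T a b ab) neq′
  ...   | inj₁ (refl , w≢r , refl) = w≢r , ab
  ...   | inj₂ (refl , w≢r , refl) = w≢r , symmetric _ _ ab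

-- R′ may traverse the edge above w in either direction.
cut-rerooted : {T : Digraph n} {R R′ : Rooting n} → IsRooting T R → IsRooting T R′ → ∀ {w a b} →
  Child R′ a b → (a ≡ parent R w × b ≡ w) ⊎ (a ≡ w × b ≡ parent R w) →
  ∀ {v} → v ≢ root R′ → v ≢ b → does (_≼?_ R w v) ≡ does (_≼?_ R w (parent R′ v))
cut-rerooted {R = R} {R′} TR TR′ {w} {a} {b} (b≢s , refl) ends {v} v≢s v≢b
  with does (_≼?_ R w v) Bool.≟ does (_≼?_ R w (parent R′ v))
... | yes eq = eq
... | no neq = ⊥-elim (only-ab (cut-edge TR (adj-sym TR′ (child⇒adj TR′ (v≢s , refl))) neq) ends)
  where
  only-ab : (parent R′ v ≡ w × Child R v (parent R′ v)) ⊎ (v ≡ w × Child R (parent R′ v) v) →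
            (a ≡ parent R w × b ≡ w) ⊎ (a ≡ w × b ≡ parent R w) → ⊥
  only-ab (inj₁ (pv≡w , _ , ppv≡v)) (inj₁ (a≡pw , b≡w)) =
    child-asym TR′ (b≢s , trans a≡pw (trans (cong (parent R) (sym pv≡w)) ppv≡v)) (v≢s , trans pv≡w (sym b≡w))
  only-ab (inj₁ (pv≡w , _ , ppv≡v)) (inj₂ (_ , b≡pw)) = v≢b (sym (trans b≡pw (trans (cong (parent R) (sym pv≡w)) ppv≡v)))
  only-ab (inj₂ (v≡w , _))         (inj₁ (_ , b≡w)) = v≢b (trans v≡w (sym b≡w))
  only-ab (inj₂ (v≡w , _ , pw≡pv)) (inj₂ (a≡w , b≡pw)) =
    child-asym TR′ (b≢s , trans a≡w (sym v≡w)) (v≢s , sym (trans b≡pw (trans (cong (parent R) (sym v≡w)) pw≡pv)))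

-- The subtree is the union of the paths from s to the elements of S.
sd≤separating : {T : Digraph n} {R : Rooting n} → IsTree T → IsRooting T R → {S : Subset n} → Nonempty S → steinerDistance T S ≤ separating R S
sd≤separating {n} {T} {R} tree TR {S} (s , s∈S) = begin
  steinerDistance T S ≤⟨ steinerDistance-least T S W F (treeF , F⊆T) S⊆W ⟩
  edgeCount F ≡⟨ edgeCount-rooting TR F symF F⊆T ⟩
  ∑ (λ v → ind (¬? (v ≟ root R) ×-dec adj? F (parent R v) v))
    ≤⟨ ∑-mono (λ w → ind-mono (¬? (w ≟ root R) ×-dec adj? F (parent R w) w) (split? (descendants R w) S) (λ (w≢r , a) → separates w≢r a)) ⟩
  separating R S ∎
  where
  open ℕ.≤-Reasoning
  -- With the tree rooted at `s`, the union of the paths from `s` to `S` is the set of vertices that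
  -- have a descendant in `S`.
  Rₛ = rooting tree s
  TRₛ : IsRooting T Rₛ
  TRₛ = isRooting tree s
  inW? : ∀ v → Dec (∃ λ x → x ∈ S × _≼_ Rₛ v x)
  inW? v = Fin.any? λ x → (x ∈? S) ×-dec _≼?_ Rₛ v x
  W : Subset n
  W = tabulate (does ∘ inW?)
  ∈W⁺ : ∀ {v} → (∃ λ x → x ∈ S × _≼_ Rₛ v x) → v ∈ W
  ∈W⁺ {v} p = ∈-tabulate⁺ (dec-true (inW? v) p)
  ∈W⁻ : ∀ {v} → v ∈ W → ∃ λ x → x ∈ S × _≼_ Rₛ v x
  ∈W⁻ {v} v∈W = does⇒ (inW? v) (∈-tabulate⁻ v∈W)
  S⊆W : S ⊆ W
  S⊆W x∈S = ∈W⁺ (_ , x∈S , ≼-refl)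
  F? : ∀ u v → Dec (Adj T u v × u ∈ W × v ∈ W)
  F? u v = adj? T u v ×-dec ((u ∈? W) ×-dec (v ∈? W))
  F : Digraph n
  F = fromRel F?
  F⊆T : ∀ u v → Adj F u v → Adj T u v
  F⊆T u v uv = proj₁ (fromRel⁻ F? uv)
  symF : ∀ u v → Adj F u v → Adj F v u
  symF u v uv with a , u∈ , v∈ ← fromRel⁻ F? uv = fromRel⁺ F? (adj-sym TR a , v∈ , u∈)
  walk : ∀ {v} → v ∈ W → Star (Adj F) v s
  walk v∈W = go v∈W (root≼ Rₛ _)
    where
    go : ∀ {v} → v ∈ W → _≼_ Rₛ s v → Star (Adj F) v s
    go v∈W ≼-refl = ε
    go {v} v∈W (below v≢s p) with x , x∈S , v≼x ← ∈W⁻ v∈W = fromRel⁺ F? (adj-sym TRₛ (child⇒adj TRₛ (v≢s , refl)) , v∈W , pv∈W) ◅ go pv∈W p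
      where
      pv∈W : parent Rₛ v ∈ W
      pv∈W = ∈W⁺ (x , x∈S , ≼-trans Rₛ (below v≢s ≼-refl) v≼x)
  treeF : IsTreeOn W F
  treeF = record
    { symmetric = symF
    ; loopless  = λ u uu → isRooting⇒loopless TR u (F⊆T u u uu)
    ; incident  = λ u v uv → proj₁ (proj₂ (fromRel⁻ F? uv))
    ; nonempty  = s , S⊆W s∈S
    ; connected = λ u v u∈ v∈ → walk⇒path (walk u∈ ◅◅ Star.reverse (symF _ _) (walk v∈))
    ; acyclic   = λ (xs , u , v , (h , l , lk , uq) , len , vu) →
        isRooting⇒acyclic TR (xs , u , v , (h , l , Linked.map (F⊆T _ _) lk , uq) , len , F⊆T v u vu)
    }
  module _ {w : Fin n} (w≢r : w ≢ root R) where
    -- Seen from `s`, the edge leads down to `b`, below which a member of `S` lies, while `s` stays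
    -- on the side of `a`. So the edge separates two members of `S`, whichever way `R` directs it.
    crosses : ∀ {a b} → Child Rₛ a b → (a ≡ parent R w × b ≡ w) ⊎ (a ≡ w × b ≡ parent R w) → b ∈ W → Split (descendants R w) S
    crosses {a} {b} ab@(b≢s , refl) ends b∈W with x , x∈S , b≼x ← ∈W⁻ b∈W =
      ⇒split s∈S x∈S λ eq → separated ends
        (trans (cut-above Rₛ const (parent Rₛ b) (⋠parent Rₛ b≢s)) (trans eq (cut-below Rₛ const b≼x)))
      where
      separated : (a ≡ parent R w × b ≡ w) ⊎ (a ≡ w × b ≡ parent R w) → does (_≼?_ R w a) ≢ does (_≼?_ R w b)
      separated (inj₁ (eq , refl)) = subst (λ z → does (_≼?_ R w z) ≢ does (_≼?_ R w b)) (sym eq) (child-separated TR (w≢r , refl))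
      separated (inj₂ (refl , eq)) = subst (λ z → does (_≼?_ R w a) ≢ does (_≼?_ R w z)) (sym eq) (child-separated TR (w≢r , refl) ∘ sym)
      const : ∀ {v} → v ≢ s → v ≢ b → does (_≼?_ R w v) ≡ does (_≼?_ R w (parent Rₛ v))
      const = cut-rerooted TR TRₛ ab ends
    separates : Adj F (parent R w) w → Split (descendants R w) S
    separates uw with a , u∈W , w∈W ← fromRel⁻ F? uw with adj⇒child TRₛ a
    ... | inj₁ c = crosses c (inj₁ (refl , refl)) w∈W
    ... | inj₂ c = crosses c (inj₂ (refl , refl)) u∈W

-- Counting the sets separated by an edge

sumOf-subsets : (f : Subset (suc n) → ℕ) →
  sumOf f (subsets (suc n)) ≡ sumOf (f ∘ (inside ∷_)) (subsets n) + sumOf (f ∘ (outside ∷_)) (subsets n)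
sumOf-subsets {n} f = trans (sumOf-++ f (map (inside ∷_) (subsets n)) _) (cong₂ _+_ (sumOf-map f _ (subsets n))
  (trans (cong (sumOf f) (++-identityʳ (map (outside ∷_) (subsets n)))) (sumOf-map f _ (subsets n))))

sumOf-zero : {A : Set} {f : A → ℕ} → (∀ x → f x ≡ 0) → ∀ xs → sumOf f xs ≡ 0
sumOf-zero h []       = refl
sumOf-zero h (x ∷ xs) = cong₂ _+_ (h x) (sumOf-zero h xs)

-- Deciding on the first vertex is Pascal's rule if it belongs to `A`; otherwise the sets containing
-- it contribute nothing.
count-⊆ : (A : Subset n) (r : ℕ) → sumOf (λ S → ind (∣ S ∣ ℕ.≟ r) * ind (S ⊆? A)) (subsets n) ≡ binom ∣ A ∣ r
count-⊆ []            zero    = refl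
count-⊆ []            (suc r) = refl
count-⊆ {suc n} (inside ∷ A)  zero    = trans (sumOf-subsets {n} _) (cong₂ _+_ (sumOf-zero (λ _ → refl) (subsets n)) (count-⊆ A 0))
count-⊆ {suc n} (inside ∷ A)  (suc r) = trans (sumOf-subsets {n} _) (cong₂ _+_ (count-⊆ A r) (count-⊆ A (suc r)))
count-⊆ {suc n} (outside ∷ A) r       = trans (sumOf-subsets {n} _)
  (cong₂ _+_ (sumOf-zero (λ S → ℕ.*-zeroʳ (ind (∣ inside ∷ S ∣ ℕ.≟ r))) (subsets n)) (count-⊆ A r))

count-subsets : ∀ n r → sumOf (λ S → ind (∣ S ∣ ℕ.≟ r)) (subsets n) ≡ binom n r
count-subsets n r = trans (sumOf-cong (λ S → sym (trans (cong (ind (∣ S ∣ ℕ.≟ r) *_) (ind-yes (S ⊆? ⊤) ⊆⊤)) (ℕ.*-identityʳ _))) (subsets n))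
  (trans (count-⊆ {n} ⊤ r) (cong (flip binom r) (∣⊤∣≡n n)))

∣∣≢0⇒nonempty : {S : Subset n} {r : ℕ} → ∣ S ∣ ≡ suc r → Nonempty S
∣∣≢0⇒nonempty {n} {S} eq with nonempty? S
... | yes ne = ne
... | no empty = contradiction (trans (sym eq) (trans (cong ∣_∣ (Empty-unique empty)) (∣⊥∣≡0 n))) λ ()

-- A member of `S` prevents both inclusions from holding at once.
split-trichotomy : (A : Subset n) {S : Subset n} → Nonempty S → ind (split? A S) + (ind (S ⊆? A) + ind (S ⊆? ∁ A)) ≡ 1
split-trichotomy A {S} (x , x∈S) = go (S ⊆? A) (S ⊆? ∁ A)
  where
  go : (d : Dec (S ⊆ A)) (e : Dec (S ⊆ ∁ A)) → ind (¬? d ×-dec ¬? e) + (ind d + ind e) ≡ 1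
  go (yes p) (yes q) = contradiction (p x∈S) (x∈∁p⇒x∉p (q x∈S))
  go (yes p) (no _)  = refl
  go (no _)  (yes q) = refl
  go (no _)  (no _)  = refl

count-split : (A : Subset n) (r : ℕ) →
  sumOf (λ S → ind (∣ S ∣ ℕ.≟ suc r) * ind (split? A S)) (subsets n) + Cut.h n r ∣ A ∣ ≡ binom n (suc r)
count-split {n} A r = begin
  sumOf s (subsets n) + Cut.h n r ∣ A ∣
    ≡⟨ cong (sumOf s (subsets n) +_) (cong₂ _+_ (sym (count-⊆ A (suc r))) (trans (cong (flip binom (suc r)) (sym (∣∁p∣≡n∸∣p∣ A))) (sym (count-⊆ (∁ A) (suc r))))) ⟩
  sumOf s (subsets n) + (sumOf a (subsets n) + sumOf b (subsets n)) ≡⟨ cong (sumOf s (subsets n) +_) (sym (sumOf-+ a b (subsets n))) ⟩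
  sumOf s (subsets n) + sumOf (λ S → a S + b S) (subsets n) ≡⟨ sumOf-+ s _ (subsets n) ⟨
  sumOf (λ S → s S + (a S + b S)) (subsets n) ≡⟨ sumOf-cong pointwise (subsets n) ⟩
  sumOf (λ S → ind (∣ S ∣ ℕ.≟ suc r)) (subsets n) ≡⟨ count-subsets n (suc r) ⟩
  binom n (suc r) ∎
  where
  open ≡-Reasoning
  s a b : Subset n → ℕ
  s S = ind (∣ S ∣ ℕ.≟ suc r) * ind (split? A S)
  a S = ind (∣ S ∣ ℕ.≟ suc r) * ind (S ⊆? A)
  b S = ind (∣ S ∣ ℕ.≟ suc r) * ind (S ⊆? ∁ A)
  pointwise : ∀ S → s S + (a S + b S) ≡ ind (∣ S ∣ ℕ.≟ suc r)
  pointwise S = go (∣ S ∣ ℕ.≟ suc r)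
    where
    factor : ∀ i x y z → i * x + (i * y + i * z) ≡ i * (x + (y + z))
    factor = solve-∀
    go : (d : Dec (∣ S ∣ ≡ suc r)) → ind d * ind (split? A S) + (ind d * ind (S ⊆? A) + ind d * ind (S ⊆? ∁ A)) ≡ ind d
    go (no _) = refl
    go d@(yes eq) = trans (factor (ind d) (ind (split? A S)) (ind (S ⊆? A)) (ind (S ⊆? ∁ A))) (cong (_+ 0) (split-trichotomy A {S} (∣∣≢0⇒nonempty {S = S} eq)))

-- Double counting of pairs of an edge and a set. The factor is `n`, not the number of edges,
-- because `w` also runs over the root, where no set is split and `Cut.h` counts all of them.
sum-separating : (R : Rooting n) (r : ℕ) →
  sumOf (λ S → ind (∣ S ∣ ℕ.≟ suc r) * separating R S) (subsets n) + ∑ (λ w → Cut.h n r (size R w)) ≡ n * binom n (suc r)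
sum-separating {n} R r = begin
  sumOf (λ S → ind (∣ S ∣ ℕ.≟ suc r) * separating R S) (subsets n) + H
    ≡⟨ cong (_+ H) (sumOf-cong (λ S → *-distribˡ-sum (ind (∣ S ∣ ℕ.≟ suc r)) (λ w → ind (split? (descendants R w) S))) (subsets n)) ⟩
  sumOf (λ S → ∑ λ w → f S w) (subsets n) + H ≡⟨ cong (_+ H) (sumOf-∑ f (subsets n)) ⟩
  ∑ (λ w → sumOf (λ S → f S w) (subsets n)) + H ≡⟨ ∑-distrib-+ (λ w → sumOf (λ S → f S w) (subsets n)) (λ w → Cut.h n r (size R w)) ⟨
  ∑ (λ w → sumOf (λ S → f S w) (subsets n) + Cut.h n r (size R w))
    ≡⟨ sum-cong-≗ (λ w → trans (cong (λ k → sumOf (λ S → f S w) (subsets n) + Cut.h n r k) (sym (descendants-size R w))) (count-split (descendants R w) r)) ⟩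
  ∑ {n} (λ _ → binom n (suc r)) ≡⟨ ∑-const n _ ⟩
  n * binom n (suc r) ∎
  where
  open ≡-Reasoning
  H = ∑ (λ w → Cut.h n r (size R w))
  f : Subset n → Fin n → ℕ
  f S w = ind (∣ S ∣ ℕ.≟ suc r) * ind (split? (descendants R w) S)

module _ {T : Digraph n} {R : Rooting n} (tree : IsTree T) (TR : IsRooting T R) (r : ℕ) where

  open ℕ.≤-Reasoning

  private
    H = ∑ λ w → Cut.h n r (size R w)

    steinerWiener-indicator : steinerWiener (suc r) T ≡ sumOf (λ S → ind (∣ S ∣ ℕ.≟ suc r) * steinerDistance T S) (subsets n)
    steinerWiener-indicator = sumOf-filter (λ S → ∣ S ∣ ℕ.≟ suc r) (steinerDistance T) (subsets n)

  -- With `steinerWiener-upper` this expresses the index as a constant minus `H`, so minimising the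
  -- index means maximising `H`.
  steinerWiener-lower : n * binom n (suc r) ≤ steinerWiener (suc r) T + H
  steinerWiener-lower = begin
    n * binom n (suc r) ≡⟨ sum-separating R r ⟨
    sumOf (λ S → ind (∣ S ∣ ℕ.≟ suc r) * separating R S) (subsets n) + H
      ≤⟨ ℕ.+-monoˡ-≤ H (sumOf-mono (λ S → ℕ.*-monoʳ-≤ (ind (∣ S ∣ ℕ.≟ suc r)) (separating≤sd tree TR S)) (subsets n)) ⟩
    sumOf (λ S → ind (∣ S ∣ ℕ.≟ suc r) * steinerDistance T S) (subsets n) + H ≡⟨ cong (_+ H) steinerWiener-indicator ⟨
    steinerWiener (suc r) T + H ∎

  steinerWiener-upper : steinerWiener (suc r) T + H ≤ n * binom n (suc r)
  steinerWiener-upper = begin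
    steinerWiener (suc r) T + H ≡⟨ cong (_+ H) steinerWiener-indicator ⟩
    sumOf (λ S → ind (∣ S ∣ ℕ.≟ suc r) * steinerDistance T S) (subsets n) + H
      ≤⟨ ℕ.+-monoˡ-≤ H (sumOf-mono (λ S → weighted S (∣ S ∣ ℕ.≟ suc r)) (subsets n)) ⟩
    sumOf (λ S → ind (∣ S ∣ ℕ.≟ suc r) * separating R S) (subsets n) + H ≡⟨ sum-separating R r ⟩
    n * binom n (suc r) ∎
    where
    weighted : ∀ S (d : Dec (∣ S ∣ ≡ suc r)) → ind d * steinerDistance T S ≤ ind d * separating R S
    -- Sets of other sizes, the empty set among them, have weight 0; `sd≤separating` requires a
    -- member.
    weighted S (no _)   = z≤n
    weighted S (yes eq) = ℕ.*-monoʳ-≤ 1 (sd≤separating tree TR (∣∣≢0⇒nonempty eq))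

-- Centroids

module _ (R : Rooting n) where

  size-strict : ∀ {u v} → _≼_ R u v → u ≢ v → size R v < size R u
  size-strict {u} {v} uv u≢v = begin-strict
    size R v <⟨ ℕ.≤-refl ⟩
    1 + size R v ≡⟨ cong (_+ size R v) (∑-δ1 u) ⟨
    ∑ (λ w → ind (w ≟ u)) + size R v ≡⟨ ∑-distrib-+ (λ w → ind (w ≟ u)) _ ⟨
    ∑ (λ w → ind (w ≟ u) + ind (_≼?_ R v w)) ≤⟨ ∑-mono pointwise ⟩
    size R u ∎
    where
    open ℕ.≤-Reasoning
    pointwise : ∀ w → ind (w ≟ u) + ind (_≼?_ R v w) ≤ ind (_≼?_ R u w)
    pointwise w with w ≟ u
    ... | no _ = ind-mono (_≼?_ R v w) (_≼?_ R u w) (≼-trans R uv)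
    ... | yes refl = ℕ.≤-reflexive (trans (cong suc (ind-no (_≼?_ R v w) (λ vw → ℕ.<⇒≱ (≺⇒rank< R uv u≢v) (≼⇒rank≤ R vw))))
                                          (sym (ind-yes (_≼?_ R w w) ≼-refl)))

∑-disjoint : {P Q : Fin n → Set} (P? : ∀ v → Dec (P v)) (Q? : ∀ v → Dec (Q v)) → (∀ v → P v → ¬ Q v) →
             ∑ (λ v → ind (P? v)) + ∑ (λ v → ind (Q? v)) ≤ n
∑-disjoint {n} P? Q? dis = begin
  ∑ (λ v → ind (P? v)) + ∑ (λ v → ind (Q? v)) ≡⟨ ∑-distrib-+ (λ v → ind (P? v)) _ ⟨
  ∑ (λ v → ind (P? v) + ind (Q? v)) ≤⟨ ∑-mono (λ v → ℕ.≤-trans (ℕ.≤-reflexive (sym (ind-⊎ (P? v) (Q? v) (λ (p , q) → dis v p q)))) (ind≤1 (P? v ⊎-dec Q? v))) ⟩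
  ∑ {n} (λ _ → 1) ≡⟨ ∑-const n 1 ⟩
  n * 1 ≡⟨ ℕ.*-identityʳ n ⟩
  n ∎
  where open ℕ.≤-Reasoning

-- The centroid is the top of a smallest subtree with more than half of the
-- vertices, in an arbitrary rooting.
module _ {T : Digraph n} (tree : IsTree T) where

  private
    R₀ = rooting tree (proj₁ (IsTreeOn.nonempty tree))
    TR₀ = isRooting tree (proj₁ (IsTreeOn.nonempty tree))

    Heavy : Fin n → Set
    Heavy v = n < 2 * size R₀ v

    heavy-root : Heavy (root R₀)
    heavy-root = subst (λ k → n < 2 * k) (sym (size-root R₀)) (ℕ.m<m+n n (pos (proj₁ (IsTreeOn.nonempty tree))))
      where
      pos : ∀ {n} → Fin n → 0 < n + 0
      pos zero    = s≤s z≤n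
      pos (suc _) = s≤s z≤n

    lightest : ∃[ m ] (∃ λ v → Heavy v × size R₀ v ≡ m) × (∀ {i} → (∃ λ v → Heavy v × size R₀ v ≡ i) → m ≤ i)
    lightest = least (λ m → Fin.any? λ v → (n ℕ.<? 2 * size R₀ v) ×-dec (size R₀ v ℕ.≟ m)) (root R₀ , heavy-root , refl)

    c : Fin n
    c = proj₁ (proj₁ (proj₂ lightest))

    heavy-c : Heavy c
    heavy-c = proj₁ (proj₂ (proj₁ (proj₂ lightest)))

    c-lightest : ∀ {v} → Heavy v → size R₀ c ≤ size R₀ v
    c-lightest {v} hv = subst (_≤ size R₀ v) (sym (proj₂ (proj₂ (proj₁ (proj₂ lightest))))) (proj₂ (proj₂ lightest) (_ , hv , refl))

    -- Two descendant sets with more than half of the vertices each must meet, so `v` and `c` have a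
    -- common descendant and are comparable. Minimality of `c` rules out `v` strictly below it.
    heavy⇒≼c : ∀ {v} → Heavy v → _≼_ R₀ v c
    heavy⇒≼c {v} hv with Fin.any? (λ w → _≼?_ R₀ v w ×-dec _≼?_ R₀ c w)
    ... | yes (w , vw , cw) with ≼-total R₀ vw cw | v ≟ c
    ...   | inj₁ vc | _ = vc
    ...   | inj₂ cv | yes refl = ≼-refl
    ...   | inj₂ cv | no v≢c = contradiction (c-lightest hv) (ℕ.<⇒≱ (size-strict R₀ cv (v≢c ∘ sym)))
    heavy⇒≼c {v} hv | no ¬common = contradiction (ℕ.+-mono-≤ both both) (ℕ.<⇒≱ too-many)
      where
      both : size R₀ v + size R₀ c ≤ n
      both = ∑-disjoint (_≼?_ R₀ v) (_≼?_ R₀ c) (λ w vw cw → ¬common (w , vw , cw))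
      regroup : ∀ a b → 2 * a + 2 * b ≡ (a + b) + (a + b)
      regroup = solve-∀
      too-many : n + n < (size R₀ v + size R₀ c) + (size R₀ v + size R₀ c)
      too-many = subst (n + n <_) (regroup (size R₀ v) (size R₀ c)) (ℕ.+-mono-< hv heavy-c)

  centroid : Rooting n
  centroid = rooting tree c

  centroid-isRooting : IsRooting T centroid
  centroid-isRooting = isRooting tree c

  private
    Rc = centroid
    TRc = centroid-isRooting

  centroid-balanced : ∀ {v} → v ≢ root centroid → 2 * size centroid v ≤ n
  centroid-balanced {v} v≢c = case (adj⇒child TR₀ (child⇒adj TRc q→v))
    where
    q = parent Rc v
    q→v : Child Rc q v
    q→v = v≢c , refl
    case : Child R₀ q v ⊎ Child R₀ v q → 2 * size Rc v ≤ n
    -- The edge has the same direction in both rootings, so `v` has the same subtree in both. If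
    -- heavy, it would contain `c`, which lies on the other side of the edge.
    case (inj₁ (v≢r , pv≡q)) = ℕ.≮⇒≥ λ heavy → v⋠c (heavy⇒≼c (subst (λ k → n < 2 * k) sizes heavy))
      where
      const : ∀ {x} → x ≢ c → x ≢ v → does (_≼?_ R₀ v x) ≡ does (_≼?_ R₀ v (parent Rc x))
      const = cut-rerooted TR₀ TRc q→v (inj₁ (sym pv≡q , refl))
      χq≡false : does (_≼?_ R₀ v q) ≡ false
      χq≡false = dec-false (_≼?_ R₀ v q) (subst (λ z → ¬ _≼_ R₀ v z) pv≡q (⋠parent R₀ v≢r))
      χc≡false : does (_≼?_ R₀ v c) ≡ false
      χc≡false = trans (sym (cut-above Rc const q (⋠parent Rc v≢c))) χq≡false
      v⋠c : ¬ _≼_ R₀ v c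
      v⋠c vc = contradiction (trans (sym χc≡false) (dec-true (_≼?_ R₀ v c) vc)) λ ()
      sizes : size Rc v ≡ size R₀ v
      sizes = sum-cong-≗ λ x → ind-cong (_≼?_ Rc v x) (_≼?_ R₀ v x)
        (λ vx → does⇒ (_≼?_ R₀ v x) (trans (cut-below Rc const vx) (dec-true (_≼?_ R₀ v v) ≼-refl)))
        (λ vx → does⇒ (_≼?_ Rc v x) (by-contra x vx))
        where
        by-contra : ∀ x → _≼_ R₀ v x → does (_≼?_ Rc v x) ≡ true
        by-contra x vx with _≼?_ Rc v x
        ... | yes _ = refl
        ... | no v⋠x = trans (sym χc≡false) (trans (sym (cut-above Rc const x v⋠x)) (dec-true (_≼?_ R₀ v x) vx))
    -- The edge is reversed. The subtree of `v` seen from `c` is then disjoint from that of `q` in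
    -- `R₀`, which contains `c` and is therefore heavy.
    case (inj₂ (q≢r , pq≡v)) = ℕ.+-cancelʳ-≤ (2 * size R₀ q) _ _ (begin
        2 * size Rc v + 2 * size R₀ q ≡⟨ ℕ.*-distribˡ-+ 2 (size Rc v) _ ⟨
        2 * (size Rc v + size R₀ q) ≤⟨ ℕ.*-monoʳ-≤ 2 (∑-disjoint (_≼?_ Rc v) (_≼?_ R₀ q) disjoint) ⟩
        2 * n ≡⟨ cong (n +_) (ℕ.+-identityʳ n) ⟩
        n + n ≤⟨ ℕ.+-monoʳ-≤ n (ℕ.<⇒≤ heavy-q) ⟩
        n + 2 * size R₀ q ∎)
      where
      open ℕ.≤-Reasoning
      const : ∀ {x} → x ≢ c → x ≢ v → does (_≼?_ R₀ q x) ≡ does (_≼?_ R₀ q (parent Rc x))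
      const = cut-rerooted TR₀ TRc q→v (inj₂ (refl , sym pq≡v))
      χv≡false : does (_≼?_ R₀ q v) ≡ false
      χv≡false = dec-false (_≼?_ R₀ q v) (subst (λ z → ¬ _≼_ R₀ q z) pq≡v (⋠parent R₀ q≢r))
      disjoint : ∀ x → _≼_ Rc v x → ¬ _≼_ R₀ q x
      disjoint x vx qx = contradiction (trans (sym (dec-true (_≼?_ R₀ q x) qx)) (trans (cut-below Rc const vx) χv≡false)) λ ()
      q≼c : _≼_ R₀ q c
      q≼c = does⇒ (_≼?_ R₀ q c) (trans (sym (cut-above Rc const q (⋠parent Rc v≢c))) (dec-true (_≼?_ R₀ q q) ≼-refl))
      heavy-q : Heavy q
      heavy-q = ℕ.<-≤-trans heavy-c (ℕ.*-monoʳ-≤ 2 (size-antitone R₀ q≼c))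

-- Degrees and levels

∑-∣∣ : (p : Subset n) → ∣ p ∣ ≡ ∑ (λ v → ind (v ∈? p))
∑-∣∣ []            = refl
∑-∣∣ (inside ∷ p)  = cong suc (∑-∣∣ p)
∑-∣∣ (outside ∷ p) = ∑-∣∣ p

module _ (R : Rooting n) where

  outdegree : Fin n → ℕ
  outdegree u = ∑ λ v → ind (child? R u v)

  ∑-outdegree : (f : Fin n → ℕ) → ∑ (λ u → f u * outdegree u) ≡ ∑ (λ v → ind (¬? (v ≟ root R)) * f (parent R v))
  ∑-outdegree f = begin
    ∑ (λ u → f u * outdegree u) ≡⟨ sum-cong-≗ (λ u → *-distribˡ-sum (f u) (λ v → ind (child? R u v))) ⟩
    ∑ (λ u → ∑ λ v → f u * ind (child? R u v)) ≡⟨ ∑-comm (λ u v → f u * ind (child? R u v)) ⟩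
    ∑ (λ v → ∑ λ u → f u * ind (child? R u v)) ≡⟨ sum-cong-≗ (λ v → sum-cong-≗ (λ u → at-parent u v)) ⟩
    ∑ (λ v → ∑ λ u → ind (u ≟ parent R v) * (ind (¬? (v ≟ root R)) * f u))
      ≡⟨ sum-cong-≗ (λ v → ∑-δ (parent R v) (λ u → ind (¬? (v ≟ root R)) * f u)) ⟩
    ∑ (λ v → ind (¬? (v ≟ root R)) * f (parent R v)) ∎
    where
    open ≡-Reasoning
    regroup : ∀ x a b → x * (a * b) ≡ b * (a * x)
    regroup = solve-∀
    at-parent : ∀ u v → f u * ind (child? R u v) ≡ ind (u ≟ parent R v) * (ind (¬? (v ≟ root R)) * f u)
    at-parent u v = trans (cong (f u *_) (trans (ind-× (¬? (v ≟ root R)) (parent R v ≟ u))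
        (cong (ind (¬? (v ≟ root R)) *_) (ind-cong (parent R v ≟ u) (u ≟ parent R v) sym sym))))
      (regroup (f u) (ind (¬? (v ≟ root R))) (ind (u ≟ parent R v)))

  -- The total weight of the ancestors of `w`, itself included. If `f` marks the complement of a
  -- nonempty ancestor-closed set, this is the distance from `w` to that set.
  above : (Fin n → ℕ) → Fin n → ℕ
  above f w = ∑ λ u → f u * ind (_≼?_ R u w)

  module _ (f : Fin n → ℕ) where

    above-child : ∀ {v} → v ≢ root R → above f v ≡ f v + above f (parent R v)
    above-child {v} v≢r = begin
      above f v ≡⟨ sum-cong-≗ (λ u → trans (cong (f u *_) (ind-≼?-below R v≢r)) (regroup (f u) (ind (u ≟ v)) (ind (_≼?_ R u (parent R v))))) ⟩
      ∑ (λ u → ind (u ≟ v) * f u + f u * ind (_≼?_ R u (parent R v))) ≡⟨ ∑-distrib-+ (λ u → ind (u ≟ v) * f u) _ ⟩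
      ∑ (λ u → ind (u ≟ v) * f u) + above f (parent R v) ≡⟨ cong (_+ above f (parent R v)) (∑-δ v f) ⟩
      f v + above f (parent R v) ∎
      where
      open ≡-Reasoning
      regroup : ∀ x a b → x * (a + b) ≡ a * x + x * b
      regroup = solve-∀

    above-root : above f (root R) ≡ f (root R)
    above-root = trans (sum-cong-≗ λ u → trans (cong (f u *_) (ind-≼?-root R u)) (ℕ.*-comm (f u) _)) (∑-δ (root R) f)

    -- Double counting of ancestor-descendant pairs. It turns the sizes of the small subtrees into a
    -- sum of distances.
    ∑-above : ∑ (above f) ≡ ∑ (λ u → f u * size R u)
    ∑-above = trans (∑-comm (λ w u → f u * ind (_≼?_ R u w)))
      (sum-cong-≗ λ u → sym (*-distribˡ-sum (f u) (λ w → ind (_≼?_ R u w))))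

    self≤above : ∀ w → f w ≤ above f w
    self≤above w = ℕ.≤-trans (ℕ.≤-reflexive (sym (trans (cong (f w *_) (ind-yes (_≼?_ R w w) ≼-refl)) (ℕ.*-identityʳ (f w)))))
                             (term≤∑ (λ u → f u * ind (_≼?_ R u w)) w)

    above-zero : ∀ {w} → (∀ {u} → _≼_ R u w → f u ≡ 0) → above f w ≡ 0
    above-zero {w} h = ∑-zero λ u → go u (_≼?_ R u w)
      where
      go : ∀ u (d : Dec (_≼_ R u w)) → f u * ind d ≡ 0
      go u (yes uw) = cong (_* 1) (h uw)
      go u (no _)   = ℕ.*-zeroʳ (f u)

degree-outdegree : {T : Digraph n} {R : Rooting n} → IsRooting T R → ∀ u → degree T u ≡ outdegree R u + ind (¬? (u ≟ root R))
degree-outdegree {T = T} {R} TR u = begin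
  degree T u ≡⟨ ∑-∣∣ (lookup T u) ⟩
  ∑ (λ v → ind (adj? T u v)) ≡⟨ sum-cong-≗ (λ v → trans
      (ind-cong (adj? T u v) (child? R u v ⊎-dec child? R v u) (adj⇒child TR) [ child⇒adj TR , adj-sym TR ∘ child⇒adj TR ]′)
      (ind-⊎ (child? R u v) (child? R v u) (λ (c , c′) → child-asym TR c c′))) ⟩
  ∑ (λ v → ind (child? R u v) + ind (child? R v u)) ≡⟨ ∑-distrib-+ (λ v → ind (child? R u v)) _ ⟩
  outdegree R u + ∑ (λ v → ind (child? R v u)) ≡⟨ cong (outdegree R u +_) (trans (sum-cong-≗ at-parent) (∑-δ (parent R u) (λ _ → ind (¬? (u ≟ root R))))) ⟩
  outdegree R u + ind (¬? (u ≟ root R)) ∎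
  where
  open ≡-Reasoning
  at-parent : ∀ v → ind (child? R v u) ≡ ind (v ≟ parent R u) * ind (¬? (u ≟ root R))
  at-parent v = trans (ind-× (¬? (u ≟ root R)) (parent R u ≟ v)) (trans (ℕ.*-comm (ind (¬? (u ≟ root R))) _)
    (cong (_* ind (¬? (u ≟ root R))) (ind-cong (parent R u ≟ v) (v ≟ parent R u) sym sym)))

-- Degrees and the largest entries of the sequence

∑-degrees : {T : Digraph n} {D : List ℕ} → HasDegreeSequence T D → (g : ℕ → ℕ) → ∑ (λ u → g (degree T u)) ≡ sumOf g D
∑-degrees {n} {T} {D} (_ , perm) g = begin
  ∑ (λ u → g (degree T u)) ≡⟨ sumOf-tabulate (g ∘ degree T) id ⟨
  sumOf (g ∘ degree T) (allFin n) ≡⟨ sumOf-map g (degree T) (allFin n) ⟨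
  sumOf g (map (degree T) (allFin n)) ≡⟨ sum-↭ (map⁺ g perm) ⟩
  sumOf g D ∎
  where open ≡-Reasoning

-- A suitable θ is the m-th entry: the first m entries exceed it and the others do not.
sum-take-threshold : ∀ m b (D : List ℕ) → Linked _≥_ (b ∷ D) → ∃[ θ ] θ ≤ b × sum (take m D) ≡ m * θ + sumOf (_∸ θ) D
sum-take-threshold zero b D sorted = b , ℕ.≤-refl , sym (none-exceeds D sorted ℕ.≤-refl)
  where
  none-exceeds : ∀ {x} D → Linked _≥_ (x ∷ D) → x ≤ b → sumOf (_∸ b) D ≡ 0
  none-exceeds []      _ _ = refl
  none-exceeds (d ∷ D) (x≥d ∷ lk) x≤b = cong₂ _+_ (ℕ.m≤n⇒m∸n≡0 (ℕ.≤-trans x≥d x≤b)) (none-exceeds D lk (ℕ.≤-trans x≥d x≤b))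
-- The list has run out; with threshold 0 the entries before count in full.
sum-take-threshold (suc m) b []      _              = 0 , z≤n , sym (trans (ℕ.+-identityʳ _) (ℕ.*-zeroʳ m))
sum-take-threshold (suc m) b (d ∷ D) (b≥d ∷ sorted) with sum-take-threshold m d D sorted
... | θ , θ≤d , eq = θ , ℕ.≤-trans θ≤d b≥d , (begin
  d + sum (take m D) ≡⟨ cong₂ _+_ (sym (ℕ.m+[n∸m]≡n θ≤d)) eq ⟩
  θ + (d ∸ θ) + (m * θ + sumOf (_∸ θ) D) ≡⟨ regroup θ (d ∸ θ) (m * θ) (sumOf (_∸ θ) D) ⟩
  θ + m * θ + (d ∸ θ + sumOf (_∸ θ) D) ∎)
  where
  open ≡-Reasoning
  regroup : ∀ a b c e → a + b + (c + e) ≡ a + c + (b + e)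
  regroup = solve-∀

module _ {T : Digraph n} {D : List ℕ} (TD : HasDegreeSequence T D) {B : Fin n → Set} (B? : ∀ v → Dec (B v)) where

  -- Each degree in `B` is at most `θ` plus its excess over `θ`, and the excesses of all vertices
  -- depend on the sequence alone. The threshold makes this bound equal to the sum of the largest
  -- entries, without matching vertices to positions.
  ∑-degrees-≤ : ∑ (λ u → ind (B? u) * degree T u) ≤ sum (take (∑ (λ u → ind (B? u))) D)
  ∑-degrees-≤ with sum-take-threshold (∑ (λ u → ind (B? u))) (sum D) D (bounded D (proj₁ TD))
    where
    bounded : ∀ D → Linked _≥_ D → Linked _≥_ (sum D ∷ D)
    bounded []      _  = [-]
    bounded (d ∷ D) lk = ℕ.m≤m+n d (sum D) ∷ lk
  ... | θ , _ , eq = begin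
    ∑ (λ u → ind (B? u) * degree T u) ≤⟨ ∑-mono (λ u → pointwise (B? u) (degree T u)) ⟩
    ∑ (λ u → ind (B? u) * θ + (degree T u ∸ θ)) ≡⟨ ∑-distrib-+ (λ u → ind (B? u) * θ) _ ⟩
    ∑ (λ u → ind (B? u) * θ) + ∑ (λ u → degree T u ∸ θ) ≡⟨ cong₂ _+_ (sym (*-distribʳ-sum θ (λ u → ind (B? u)))) (∑-degrees {T = T} TD (_∸ θ)) ⟩
    ∑ (λ u → ind (B? u)) * θ + sumOf (_∸ θ) D ≡⟨ eq ⟨
    sum (take (∑ (λ u → ind (B? u))) D) ∎
    where
    open ℕ.≤-Reasoning
    pointwise : {P : Set} (d : Dec P) → ∀ x → ind d * x ≤ ind d * θ + (x ∸ θ)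
    pointwise (no _)  x = z≤n
    pointwise (yes _) x = subst₂ _≤_ (sym (ℕ.+-identityʳ x)) (cong (_+ (x ∸ θ)) (sym (ℕ.+-identityʳ θ))) (ℕ.m≤n+m∸n x θ)

-- All vertices but the root have their parent as a neighbour.
childCounts : ℕ → List ℕ → List ℕ
childCounts d ds = d ∷ map pred ds

sum-take-pred : ∀ m ds → sum (take m ds) ≤ sum (take m (map pred ds)) + m
sum-take-pred zero    ds       = z≤n
sum-take-pred (suc m) []       = z≤n
sum-take-pred (suc m) (d ∷ ds) = begin
  d + sum (take m ds) ≤⟨ ℕ.+-mono-≤ (d≤ d) (sum-take-pred m ds) ⟩
  pred d + 1 + (sum (take m (map pred ds)) + m) ≡⟨ regroup (pred d) _ m ⟩
  pred d + sum (take m (map pred ds)) + suc m ∎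
  where
  open ℕ.≤-Reasoning
  d≤ : ∀ d → d ≤ pred d + 1
  d≤ zero    = z≤n
  d≤ (suc d) = ℕ.≤-reflexive (ℕ.+-comm 1 d)
  regroup : ∀ a b m → a + 1 + (b + m) ≡ a + b + (1 + m)
  regroup = solve-∀

sum-take-mono : ∀ {m m′} (xs : List ℕ) → m ≤ m′ → sum (take m xs) ≤ sum (take m′ xs)
sum-take-mono xs       z≤n     = z≤n
sum-take-mono []       (s≤s _) = z≤n
sum-take-mono (x ∷ xs) (s≤s l) = ℕ.+-monoʳ-≤ x (sum-take-mono xs l)

-- Counts the root and all children of the first m vertices.
Φ : List ℕ → ℕ → ℕ
Φ os m = suc (sum (take m os))

Φ-mono : ∀ os {m m′} → m ≤ m′ → Φ os m ≤ Φ os m′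
Φ-mono os l = s≤s (sum-take-mono os l)

-- Bounds the number of vertices within distance `t` of an ancestor-closed set of `k` vertices.
level : List ℕ → ℕ → ℕ → ℕ
level os k zero    = k
level os k (suc t) = Φ os (level os k t)

count-complement : {P : Fin n → Set} {Q : Fin n → Set} (P? : ∀ v → Dec (P v)) (Q? : ∀ v → Dec (Q v)) → (∀ v → ¬ P v → Q v) →
  n ≤ ∑ (λ v → ind (P? v)) + ∑ (λ v → ind (Q? v))
count-complement {n} P? Q? cover = begin
  n ≡⟨ ℕ.*-identityʳ n ⟨
  n * 1 ≡⟨ ∑-const n 1 ⟨
  ∑ {n} (λ _ → 1) ≤⟨ ∑-mono (λ v → ℕ.≤-trans (ℕ.≤-reflexive (sym (ind-¬ (P? v)))) (ℕ.+-monoʳ-≤ (ind (P? v)) (ind-mono (¬? (P? v)) (Q? v) (cover v)))) ⟩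
  ∑ (λ v → ind (P? v) + ind (Q? v)) ≡⟨ ∑-distrib-+ (λ v → ind (P? v)) _ ⟩
  ∑ (λ v → ind (P? v)) + ∑ (λ v → ind (Q? v)) ∎
  where open ℕ.≤-Reasoning

-- Layer-cake summation: `f w ⊓ N` is the number of `t` below both `N` and `f w`.
∑-levels : (f : Fin n → ℕ) → ∀ N → Σ< N (λ t → ∑ λ w → ind (t ℕ.<? f w)) ≡ ∑ (λ w → f w ⊓ N)
∑-levels f N = trans (Σ<-∑ N (λ t w → ind (t ℕ.<? f w))) (sum-cong-≗ λ w → Σ<-indicator N (f w))

-- Truncated subtree sizes in an arbitrary tree

module _ {T : Digraph n} {R : Rooting n} (TR : IsRooting T R) {d : ℕ} {ds : List ℕ} (TD : HasDegreeSequence T (d ∷ ds)) where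

  private
    os = childCounts d ds

  -- The left-hand side counts the root and the vertices whose parent lies in B.
  neighbourhood-≤ : {B : Fin n → Set} (B? : ∀ v → Dec (B v)) → B (root R) →
    1 + ∑ (λ u → ind (B? u) * outdegree R u) ≤ Φ os (∑ (λ u → ind (B? u)))
  neighbourhood-≤ B? r∈B = bound (∑ (λ u → ind (B? u))) #B refl
    where
    open ℕ.≤-Reasoning
    -- The vertices of `B` other than the root. Each has one parent among its neighbours, so degrees
    -- exceed child counts by `m′` in total.
    m′ = ∑ (λ u → ind (B? u) * ind (¬? (u ≟ root R)))
    #B : ∑ (λ u → ind (B? u)) ≡ 1 + m′
    #B = begin-equality
      ∑ (λ u → ind (B? u)) ≡⟨ sum-cong-≗ (λ u → trans (sym (ℕ.*-identityʳ (ind (B? u)))) (trans (cong (ind (B? u) *_) (sym (ind-¬ (u ≟ root R)))) (regroup (ind (B? u)) (ind (u ≟ root R)) _))) ⟩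
      ∑ (λ u → ind (u ≟ root R) * ind (B? u) + ind (B? u) * ind (¬? (u ≟ root R))) ≡⟨ ∑-distrib-+ (λ u → ind (u ≟ root R) * ind (B? u)) _ ⟩
      ∑ (λ u → ind (u ≟ root R) * ind (B? u)) + m′ ≡⟨ cong (_+ m′) (trans (∑-δ (root R) (λ u → ind (B? u))) (ind-yes (B? (root R)) r∈B)) ⟩
      1 + m′ ∎
      where
      regroup : ∀ x a b → x * (a + b) ≡ a * x + x * b
      regroup = solve-∀
    bound : ∀ m → m ≡ 1 + m′ → ∑ (λ u → ind (B? u)) ≡ m → 1 + ∑ (λ u → ind (B? u) * outdegree R u) ≤ Φ os m
    bound m refl eq = s≤s (ℕ.+-cancelʳ-≤ m′ _ _ (begin
      ∑ (λ u → ind (B? u) * outdegree R u) + m′ ≡⟨ ∑-distrib-+ (λ u → ind (B? u) * outdegree R u) _ ⟨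
      ∑ (λ u → ind (B? u) * outdegree R u + ind (B? u) * ind (¬? (u ≟ root R)))
        ≡⟨ sum-cong-≗ (λ u → trans (sym (ℕ.*-distribˡ-+ (ind (B? u)) (outdegree R u) _)) (cong (ind (B? u) *_) (sym (degree-outdegree TR u)))) ⟩
      ∑ (λ u → ind (B? u) * degree T u) ≤⟨ ∑-degrees-≤ {T = T} TD B? ⟩
      sum (take (∑ (λ u → ind (B? u))) (d ∷ ds)) ≡⟨ cong (λ k → sum (take k (d ∷ ds))) eq ⟩
      d + sum (take m′ ds) ≤⟨ ℕ.+-monoʳ-≤ d (sum-take-pred m′ ds) ⟩
      d + (sum (take m′ (map pred ds)) + m′) ≡⟨ ℕ.+-assoc d _ m′ ⟨
      sum (take (1 + m′) os) + m′ ∎))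

  module _ {j : ℕ} (j≤n : j ≤ n) where

    open ℕ.≤-Reasoning

    private
      large? : ∀ v → Dec (j ≤ size R v)
      large? v = j ℕ.≤? size R v

      k = ∑ λ v → ind (large? v)

      small : Fin n → ℕ
      small v = ind (¬? (large? v))

      large⇒small≡0 : ∀ {v} → j ≤ size R v → small v ≡ 0
      large⇒small≡0 {v} l = ind-no (¬? (large? v)) (λ ¬l → ¬l l)

      height : Fin n → ℕ
      height = above R small

      ball? : ∀ t v → Dec (height v ≤ t)
      ball? t v = height v ℕ.≤? t

      height-root : height (root R) ≡ 0
      height-root = trans (above-root R small) (large⇒small≡0 (subst (j ≤_) (sym (size-root R)) j≤n))

      -- Above a large vertex everything is large and the height is 0; a small vertex counts itself,
      -- so its parent has height one less.
      height-parent : ∀ {v t} → v ≢ root R → height v ≤ suc t → height (parent R v) ≤ t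
      height-parent {v} {t} v≢r hv with large? v
      ... | yes l = subst (_≤ t) (sym (above-zero R small λ up → large⇒small≡0 (ℕ.≤-trans l (size-antitone R (≼-trans R up (below v≢r ≼-refl)))))) z≤n
      ... | no ¬l = ℕ.+-cancelˡ-≤ 1 _ _ (subst (_≤ suc t) (trans (above-child R small v≢r) (cong (_+ height (parent R v)) (ind-yes (¬? (large? v)) ¬l))) hv)

      #ball : ℕ → ℕ
      #ball t = ∑ λ v → ind (ball? t v)

      -- A vertex of height 0 does not count itself, so it is large. At height at most `suc t` a
      -- vertex is the root or a child of one in the previous ball, and `neighbourhood-≤` bounds
      -- their number.
      ball≤level : ∀ t → #ball t ≤ level os k t
      ball≤level zero = ∑-mono λ v → ind-mono (ball? 0 v) (large? v) (on-top v)
        where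
        on-top : ∀ v → height v ≤ 0 → j ≤ size R v
        on-top v h with large? v
        ... | yes l = l
        ... | no ¬l = contradiction (ℕ.≤-trans (ℕ.≤-reflexive (sym (ind-yes (¬? (large? v)) ¬l))) (ℕ.≤-trans (self≤above R small v) h)) λ ()
      ball≤level (suc t) = begin
        #ball (suc t) ≤⟨ ∑-mono near ⟩
        ∑ (λ v → ind (v ≟ root R) + ind (¬? (v ≟ root R)) * ind (ball? t (parent R v))) ≡⟨ ∑-distrib-+ (λ v → ind (v ≟ root R)) _ ⟩
        ∑ (λ v → ind (v ≟ root R)) + ∑ (λ v → ind (¬? (v ≟ root R)) * ind (ball? t (parent R v)))
          ≡⟨ cong₂ _+_ (∑-δ1 (root R)) (sym (∑-outdegree R (λ u → ind (ball? t u)))) ⟩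
        1 + ∑ (λ u → ind (ball? t u) * outdegree R u) ≤⟨ neighbourhood-≤ (ball? t) (subst (_≤ t) (sym height-root) z≤n) ⟩
        Φ os (#ball t) ≤⟨ Φ-mono os (ball≤level t) ⟩
        level os k (suc t) ∎
        where
        near : ∀ v → ind (ball? (suc t) v) ≤ ind (v ≟ root R) + ind (¬? (v ≟ root R)) * ind (ball? t (parent R v))
        near v with v ≟ root R
        ... | yes _ = ℕ.≤-trans (ind≤1 (ball? (suc t) v)) (ℕ.m≤m+n 1 _)
        ... | no v≢r = ℕ.≤-trans (ind-mono (ball? (suc t) v) (ball? t (parent R v)) (height-parent v≢r)) (ℕ.≤-reflexive (sym (ℕ.+-identityʳ _)))

    -- Large vertices contribute `j` each, and the sizes of the small ones add up to the heights.
    -- Summed by layers, at least `n ∸ level os k t` vertices have height above `t`.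
    truncated-sizes-lower : ∃[ k ] k * j + Σ< n (λ t → n ∸ level os k t) ≤ ∑ (λ v → size R v ⊓ j)
    truncated-sizes-lower = k , (begin
      k * j + Σ< n (λ t → n ∸ level os k t) ≤⟨ ℕ.+-monoʳ-≤ (k * j) (Σ<-mono n outside-ball) ⟩
      k * j + Σ< n (λ t → ∑ λ w → ind (t ℕ.<? height w)) ≡⟨ cong (k * j +_) (∑-levels height n) ⟩
      k * j + ∑ (λ w → height w ⊓ n) ≤⟨ ℕ.+-monoʳ-≤ (k * j) (∑-mono λ w → ℕ.m⊓n≤m (height w) n) ⟩
      k * j + ∑ height ≡⟨ cong₂ _+_ (*-distribʳ-sum j (λ v → ind (large? v))) (∑-above R small) ⟩
      ∑ (λ v → ind (large? v) * j) + ∑ (λ v → small v * size R v) ≡⟨ ∑-distrib-+ (λ v → ind (large? v) * j) _ ⟨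
      ∑ (λ v → ind (large? v) * j + small v * size R v) ≡⟨ sum-cong-≗ (λ v → truncate v (large? v)) ⟩
      ∑ (λ v → size R v ⊓ j) ∎)
      where
      outside-ball : ∀ t → n ∸ level os k t ≤ ∑ λ w → ind (t ℕ.<? height w)
      outside-ball t = ℕ.m≤n+o⇒m∸n≤o n (level os k t) (ℕ.≤-trans
        (count-complement (ball? t) (λ w → t ℕ.<? height w) (λ w → ℕ.≰⇒>)) (ℕ.+-monoˡ-≤ _ (ball≤level t)))
      truncate : ∀ v (l? : Dec (j ≤ size R v)) → ind l? * j + ind (¬? l?) * size R v ≡ size R v ⊓ j
      truncate v (yes l) = trans (ℕ.+-identityʳ _) (trans (ℕ.+-identityʳ j) (sym (ℕ.m≥n⇒m⊓n≡n l)))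
      truncate v (no ¬l) = trans (ℕ.+-identityʳ _) (sym (ℕ.m≤n⇒m⊓n≡m (ℕ.<⇒≤ (ℕ.≰⇒> ¬l))))

-- Truncated subtree sizes under a breadth-first labelling

count-< : ∀ k → ∑ (λ (w : Fin n) → ind (toℕ w ℕ.<? k)) ≤ k
count-< {zero}  k       = z≤n
count-< {suc n} zero    = ℕ.≤-reflexive (sum-replicate-zero (suc n))
count-< {suc n} (suc k) = s≤s (count-< {n} k)

count-≥ : ∀ k → ∑ (λ (w : Fin n) → ind (k ℕ.≤? toℕ w)) ≤ n ∸ k
count-≥ {zero}  k       = z≤n
count-≥ {suc n} zero    = ℕ.≤-reflexive (trans (∑-const (suc n) 1) (ℕ.*-identityʳ (suc n)))
count-≥ {suc n} (suc k) = ℕ.≤-trans (∑-mono {n} (λ w → ind-mono (suc k ℕ.≤? suc (toℕ w)) (k ℕ.≤? toℕ w) ℕ.≤-pred)) (count-≥ {n} k)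

-- Here os lists the numbers of children in breadth-first order.
module _ (R : Rooting n) (os : List ℕ) (increasing : ∀ {u v} → _≼_ R u v → toℕ u ≤ toℕ v)
         (breadth-first : ∀ m {v} → v ≢ root R → toℕ v < Φ os m → toℕ (parent R v) < m) where

  open ℕ.≤-Reasoning

  -- The first `k` labels replace the large vertices. Both `j` and the size bound a truncated size
  -- from above, so it does not matter whether these labels have the largest subtrees, and any `k`
  -- is allowed.
  truncated-sizes-upper : ∀ j k → ∑ (λ v → size R v ⊓ j) ≤ k * j + Σ< n (λ t → n ∸ level os k t)
  truncated-sizes-upper j k = begin
    ∑ (λ v → size R v ⊓ j) ≤⟨ ∑-mono (λ v → truncate v (top? v)) ⟩
    ∑ (λ v → ind (top? v) * j + rest v * size R v) ≡⟨ ∑-distrib-+ (λ v → ind (top? v) * j) _ ⟩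
    ∑ (λ v → ind (top? v) * j) + ∑ (λ v → rest v * size R v) ≡⟨ cong₂ _+_ (sym (*-distribʳ-sum j (λ v → ind (top? v)))) (sym (∑-above R rest)) ⟩
    ∑ (λ v → ind (top? v)) * j + ∑ height ≤⟨ ℕ.+-mono-≤ (ℕ.*-monoˡ-≤ j (count-< {n} k)) (∑-mono (λ w → ℕ.≤-reflexive (sym (ℕ.m≤n⇒m⊓n≡m (height≤n w))))) ⟩
    k * j + ∑ (λ w → height w ⊓ n) ≡⟨ cong (k * j +_) (∑-levels height n) ⟨
    k * j + Σ< n (λ t → ∑ λ w → ind (t ℕ.<? height w)) ≤⟨ ℕ.+-monoʳ-≤ (k * j) (Σ<-mono n λ t →
        ℕ.≤-trans (∑-mono λ w → ind-mono (t ℕ.<? height w) (level os k t ℕ.≤? toℕ w) (λ t<h → ℕ.≮⇒≥ λ w<l → ℕ.<⇒≱ t<h (height≤ t w w<l)))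
                  (count-≥ {n} (level os k t))) ⟩
    k * j + Σ< n (λ t → n ∸ level os k t) ∎
    where
    top? : (v : Fin n) → Dec (toℕ v < k)
    top? v = toℕ v ℕ.<? k
    rest : Fin n → ℕ
    rest v = ind (¬? (top? v))
    height : Fin n → ℕ
    height = above R rest
    truncate : ∀ v (t? : Dec (toℕ v < k)) → size R v ⊓ j ≤ ind t? * j + ind (¬? t?) * size R v
    truncate v (yes _) = ℕ.≤-trans (ℕ.m⊓n≤n (size R v) j) (ℕ.≤-reflexive (sym (trans (ℕ.+-identityʳ _) (ℕ.+-identityʳ j))))
    truncate v (no _)  = ℕ.≤-trans (ℕ.m⊓n≤m (size R v) j) (ℕ.≤-reflexive (sym (ℕ.+-identityʳ _)))
    height≤n : ∀ w → height w ≤ n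
    height≤n w = ℕ.≤-trans (∑-mono {g = λ _ → 1} (λ u → ℕ.*-mono-≤ (ind≤1 (¬? (top? u))) (ind≤1 (_≼?_ R u w))))
      (ℕ.≤-reflexive (trans (∑-const n 1) (ℕ.*-identityʳ n)))
    -- A label below the next level has its parent below the current one, so each level adds at most
    -- 1 to the height.
    height≤ : ∀ t w → toℕ w < level os k t → height w ≤ t
    height≤ zero    w w<k = ℕ.≤-reflexive (above-zero R rest λ {u} up →
      ind-no (¬? (top? u)) (λ ¬top → ¬top (ℕ.≤-<-trans (increasing up) w<k)))
    height≤ (suc t) w w<l = by-root (w ≟ root R)
      where
      by-root : Dec (w ≡ root R) → height w ≤ suc t
      -- For `k` equal to 0 the root counts itself and has height 1.
      by-root (yes refl) = ℕ.≤-trans (ℕ.≤-reflexive (above-root R rest)) (ℕ.≤-trans (ind≤1 (¬? (top? w))) (s≤s z≤n))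
      by-root (no w≢r) = ℕ.≤-trans (ℕ.≤-reflexive (above-child R rest w≢r))
        (ℕ.+-mono-≤ (ind≤1 (¬? (top? w))) (height≤ t (parent R w) (breadth-first (level os k t) w≢r w<l)))

-- Numerical conditions on tree degree sequences

module _ {T : Digraph n} (tree : IsTree T) where

  -- Rooted at the other vertex `v`, the tree gives `u` a parent.
  degree≥1 : {u v : Fin n} → u ≢ v → 1 ≤ degree T u
  degree≥1 {u} {v} u≢v = begin
    1 ≡⟨ ind-yes (¬? (u ≟ v)) u≢v ⟨
    ind (¬? (u ≟ v)) ≤⟨ ℕ.m≤n+m _ _ ⟩
    outdegree (rooting tree v) u + ind (¬? (u ≟ v)) ≡⟨ degree-outdegree (isRooting tree v) u ⟨
    degree T u ∎
    where open ℕ.≤-Reasoning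

  handshake : ∑ (degree T) + 2 ≡ n + n
  handshake = begin
    ∑ (degree T) + 2 ≡⟨ cong (_+ 2) (trans (sum-cong-≗ (degree-outdegree TR)) (∑-distrib-+ (outdegree R) _)) ⟩
    ∑ (outdegree R) + m + 2 ≡⟨ cong (λ k → k + m + 2) outdegrees ⟩
    m + m + 2 ≡⟨ regroup m ⟩
    (m + 1) + (m + 1) ≡⟨ cong₂ _+_ nonroots nonroots ⟩
    n + n ∎
    where
    open ≡-Reasoning
    c = proj₁ (IsTreeOn.nonempty tree)
    R = rooting tree c
    TR : IsRooting T R
    TR = isRooting tree c
    m = ∑ λ u → ind (¬? (u ≟ c))
    regroup : ∀ m → m + m + 2 ≡ (m + 1) + (m + 1)
    regroup = solve-∀
    outdegrees : ∑ (outdegree R) ≡ m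
    outdegrees = trans (sum-cong-≗ λ u → sym (ℕ.*-identityˡ (outdegree R u)))
      (trans (∑-outdegree R (λ _ → 1)) (sum-cong-≗ λ u → ℕ.*-identityʳ (ind (¬? (u ≟ c)))))
    nonroots : m + 1 ≡ n
    nonroots = begin
      m + 1 ≡⟨ cong (m +_) (∑-δ1 c) ⟨
      m + ∑ (λ u → ind (u ≟ c)) ≡⟨ ∑-distrib-+ (λ u → ind (¬? (u ≟ c))) _ ⟨
      ∑ (λ u → ind (¬? (u ≟ c)) + ind (u ≟ c)) ≡⟨ sum-cong-≗ (λ u → trans (ℕ.+-comm (ind (¬? (u ≟ c))) _) (ind-¬ (u ≟ c))) ⟩
      ∑ {n} (λ _ → 1) ≡⟨ ∑-const n 1 ⟩
      n * 1 ≡⟨ ℕ.*-identityʳ n ⟩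
      n ∎

sequence-length : {T : Digraph n} {D : List ℕ} → HasDegreeSequence T D → n ≡ length D
sequence-length {n} {T} (_ , perm) =
  trans (sym (trans (length-map (degree T) (allFin n)) (length-tabulate id))) (↭-length perm)

sum-pred : ∀ {ds} → All (1 ≤_) ds → sum ds ≡ sum (map pred ds) + length ds
sum-pred []                       = refl
sum-pred {suc d ∷ ds} (s≤s _ ∷ all) = trans (cong (suc d +_) (sum-pred all)) (regroup d _ _)
  where
  regroup : ∀ a b c → suc a + (b + c) ≡ a + b + suc c
  regroup = solve-∀

-- What the greedy construction needs: `total` says that the child counts add up to the number of
-- non-root vertices, and `root-child` keeps the initial queue from being empty.
record Realizable (d : ℕ) (ds : List ℕ) : Set where
  field
    sorted     : Linked _≥_ (d ∷ ds)
    positive   : All (1 ≤_) ds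
    root-child : 0 < length ds → 0 < d
    total      : d + sum (map pred ds) ≡ length ds

realizable : {T : Digraph n} {d : ℕ} {ds : List ℕ} → IsTree T → HasDegreeSequence T (d ∷ ds) → Realizable d ds
realizable {n} {T} {d} {ds} tree seq@(sorted , perm) with refl ← sequence-length {T = T} seq = record
  { sorted     = sorted
  ; positive   = positive ds refl
  ; root-child = λ 0<len → All.head (all-positive 0<len)
  ; total      = ℕ.+-cancelʳ-≡ (length ds + 2) _ _ (begin
      d + sum (map pred ds) + (length ds + 2) ≡⟨ regroup d _ _ ⟩
      d + (sum (map pred ds) + length ds) + 2 ≡⟨ cong (λ k → d + k + 2) (sum-pred (positive ds refl)) ⟨
      d + sum ds + 2 ≡⟨ cong (_+ 2) (cong (d +_) (cong sum (sym (map-id ds)))) ⟩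
      sumOf id (d ∷ ds) + 2 ≡⟨ cong (_+ 2) (∑-degrees {T = T} seq id) ⟨
      ∑ (degree T) + 2 ≡⟨ handshake tree ⟩
      suc (length ds) + suc (length ds) ≡⟨ regroup′ (length ds) ⟩
      length ds + (length ds + 2) ∎)
  }
  where
  open ≡-Reasoning
  regroup : ∀ a b c → a + b + (c + 2) ≡ a + (b + c) + 2
  regroup = solve-∀
  regroup′ : ∀ a → suc a + suc a ≡ a + (a + 2)
  regroup′ = solve-∀
  distinct : ∀ {m} → 0 < m → (u : Fin (suc m)) → ∃ λ v → u ≢ v
  distinct {suc m} _ zero    = suc zero , λ ()
  distinct {suc m} _ (suc u) = zero , λ ()
  all-positive : 0 < length ds → All (1 ≤_) (d ∷ ds)
  all-positive 0<len = All-resp-↭ perm (All.map⁺ (All.tabulate⁺ λ u → degree≥1 tree (proj₂ (distinct 0<len u))))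
  -- A single vertex has degree 0, but this entry is `d`, and then `ds` is empty.
  positive : ∀ xs → ds ≡ xs → All (1 ≤_) xs
  positive []       _    = []
  positive (_ ∷ _) refl = All.tail (all-positive (s≤s z≤n))

-- The greedy tree

numbered : ℕ → List ℕ → List (ℕ × ℕ)
numbered k []       = []
numbered k (p ∷ ps) = (p , k) ∷ numbered (suc k) ps

-- the parents that the queue assigns to the next vertices, in order
pending : List (ℕ × ℕ) → List ℕ
pending []            = []
pending ((p , s) ∷ q) = replicate s p ++ pending q

-- The parents of the successive vertices in breadth-first order: each label is repeated once per
-- child.
blocks : ℕ → List ℕ → List ℕ
blocks i []       = []
blocks i (o ∷ os) = replicate o i ++ blocks (suc i) os

pending-++ : ∀ q q′ → pending (q ++ q′) ≡ pending q ++ pending q′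
pending-++ []            q′ = refl
pending-++ ((p , s) ∷ q) q′ = trans (cong (replicate s p ++_) (pending-++ q q′)) (sym (++-assoc (replicate s p) (pending q) (pending q′)))

sum-pred-zero : ∀ {d ds} → Linked _≥_ (d ∷ ds) → pred d ≡ 0 → sum (map pred ds) ≡ 0
sum-pred-zero [-]          _  = refl
sum-pred-zero {ds = e ∷ _} (d≥e ∷ lk) d≡0 = cong₂ _+_ e≡0 (sum-pred-zero lk e≡0)
  where
  e≡0 : pred e ≡ 0
  e≡0 = ℕ.n≤0⇒n≡0 (subst (pred e ≤_) d≡0 (ℕ.pred-mono-≤ d≥e))

-- The queue can only run empty once all remaining degrees are at most 1,
-- and then the count shows that none remain.
greedyEdges-numbered : ∀ q k ds → Linked _≥_ ds → length (pending q) + sum (map pred ds) ≡ length ds →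
  (0 < length ds → 0 < length (pending q)) →
  greedyEdges q k ds ≡ numbered k (pending q ++ blocks k (map pred ds))
greedyEdges-numbered q k [] _ total _ with pending q
... | [] = refl
greedyEdges-numbered [] k (d ∷ ds) _ _ ne = contradiction (ne (s≤s z≤n)) λ ()
greedyEdges-numbered ((p , zero) ∷ q) k ds@(_ ∷ _) sorted total ne = greedyEdges-numbered q k ds sorted total ne
greedyEdges-numbered ((p , suc s) ∷ q) k (d ∷ ds) sorted total ne = cong ((p , k) ∷_)
  (trans (greedyEdges-numbered q′ (suc k) ds (Linked.tail sorted) total′ ne′) (cong (numbered (suc k)) stream))
  where
  q′ = ((p , s) ∷ q) ++ [ (k , d ∸ 1) ]
  old = replicate s p ++ pending q
  pending-q′ : pending q′ ≡ old ++ replicate (pred d) k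
  pending-q′ = trans (pending-++ ((p , s) ∷ q) [ (k , d ∸ 1) ]) (cong (old ++_) (++-identityʳ _))
  length-q′ : length (pending q′) ≡ length old + pred d
  length-q′ = trans (cong length pending-q′) (trans (length-++ old) (cong (length old +_) (length-replicate (pred d))))
  -- The slots of the new vertex `k` join the end of the queue, exactly where its block begins.
  stream : pending q′ ++ blocks (suc k) (map pred ds) ≡ old ++ replicate (pred d) k ++ blocks (suc k) (map pred ds)
  stream = trans (cong (_++ blocks (suc k) (map pred ds)) pending-q′) (++-assoc old _ _)
  total′ : length (pending q′) + sum (map pred ds) ≡ length ds
  total′ = trans (cong (_+ sum (map pred ds)) length-q′) (trans (ℕ.+-assoc (length old) _ _) (ℕ.suc-injective total))
  ne′ : 0 < length ds → 0 < length (pending q′)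
  ne′ 0<len = ℕ.≰⇒> λ empty → ℕ.<-irrefl (exhausted (ℕ.n≤0⇒n≡0 empty)) 0<len
    where
    exhausted : length (pending q′) ≡ 0 → 0 ≡ length ds
    exhausted eq = trans (sym (cong₂ _+_ eq (sum-pred-zero sorted (ℕ.m+n≡0⇒n≡0 (length old) (trans (sym length-q′) eq))))) total′

greedyEdges-increasing : ∀ q k ds → All (λ (p , _) → p < k) q → All (λ (p , c) → p < c) (greedyEdges q k ds)
greedyEdges-increasing q                 k []         _          = []
greedyEdges-increasing []                k (_ ∷ _)    _          = []
greedyEdges-increasing ((p , zero) ∷ q)  k ds@(_ ∷ _) (_ ∷ q<k)   = greedyEdges-increasing q k ds q<k
greedyEdges-increasing ((p , suc s) ∷ q) k (d ∷ ds)   (p<k ∷ q<k) = p<k ∷ greedyEdges-increasing _ (suc k) ds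
  (All.++⁺ (ℕ.m≤n⇒m≤1+n p<k ∷ All.map ℕ.m≤n⇒m≤1+n q<k) (ℕ.≤-refl ∷ []))

-- 0 beyond the end of the list
at : List ℕ → ℕ → ℕ
at []       i       = 0
at (x ∷ xs) zero    = x
at (x ∷ xs) (suc i) = at xs i

numbered-at : ∀ {P : ℕ × ℕ → Set} k ps → All P (numbered k ps) → ∀ {i} → i < length ps → P (at ps i , k + i)
numbered-at {P} k (p ∷ ps) (px ∷ _)  {zero}  _       = subst (λ z → P (p , z)) (sym (ℕ.+-identityʳ k)) px
numbered-at {P} k (p ∷ ps) (_ ∷ all) {suc i} (s≤s l) = subst (λ z → P (at ps i , z)) (sym (ℕ.+-suc k i)) (numbered-at {P} (suc k) ps all l)

∈-numbered⁻ : ∀ k ps {u v} → (u , v) L.∈ numbered k ps → ∃[ i ] v ≡ k + i × u ≡ at ps i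
∈-numbered⁻ k (p ∷ ps) (here refl) = 0 , sym (ℕ.+-identityʳ k) , refl
∈-numbered⁻ k (p ∷ ps) (there m) with i , eq , at≡ ← ∈-numbered⁻ (suc k) ps m = suc i , trans eq (sym (ℕ.+-suc k i)) , at≡

sumOf-replicate : ∀ (f : ℕ → ℕ) m x → sumOf f (replicate m x) ≡ m * f x
sumOf-replicate f zero    x = refl
sumOf-replicate f (suc m) x = cong (f x +_) (sumOf-replicate f m x)

blocks-none : ∀ j u os → u < j → sumOf (λ p → ind (p ℕ.≟ u)) (blocks j os) ≡ 0
blocks-none j u []       u<j = refl
blocks-none j u (o ∷ os) u<j = trans (sumOf-++ (λ p → ind (p ℕ.≟ u)) (replicate o j) _)
  (cong₂ _+_ (trans (sumOf-replicate _ o j) (trans (cong (o *_) (ind-no (j ℕ.≟ u) (λ eq → ℕ.<-irrefl (sym eq) u<j))) (ℕ.*-zeroʳ o)))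
             (blocks-none (suc j) u os (ℕ.m≤n⇒m≤1+n u<j)))

blocks-count : ∀ j os x → sumOf (λ p → ind (p ℕ.≟ j + x)) (blocks j os) ≡ at os x
blocks-count j []       x       = refl
blocks-count j (o ∷ os) zero    = trans (sumOf-++ (λ p → ind (p ℕ.≟ j + 0)) (replicate o j) _)
  (trans (cong₂ _+_ (trans (sumOf-replicate _ o j) (trans (cong (o *_) (ind-yes (j ℕ.≟ j + 0) (sym (ℕ.+-identityʳ j)))) (ℕ.*-identityʳ o)))
                    (blocks-none (suc j) (j + 0) os (s≤s (ℕ.≤-reflexive (ℕ.+-identityʳ j))))) (ℕ.+-identityʳ o))
blocks-count j (o ∷ os) (suc x) = trans (sumOf-++ (λ p → ind (p ℕ.≟ j + suc x)) (replicate o j) _)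
  (cong₂ _+_ (trans (sumOf-replicate _ o j) (trans (cong (o *_) (ind-no (j ℕ.≟ j + suc x) (λ eq → ℕ.m≢1+m+n j (trans eq (ℕ.+-suc j x))))) (ℕ.*-zeroʳ o)))
             (trans (cong (λ u → sumOf (λ p → ind (p ℕ.≟ u)) (blocks (suc j) os)) (ℕ.+-suc j x)) (blocks-count (suc j) os x)))

length-blocks : ∀ j os → length (blocks j os) ≡ sum os
length-blocks j []       = refl
length-blocks j (o ∷ os) = trans (length-++ (replicate o j)) (cong₂ _+_ (length-replicate o) (length-blocks (suc j) os))

-- These positions are filled by the first `m` blocks, whose labels start at `j`. This is the source
-- of the breadth-first property.
blocks-< : ∀ j os m i → i < sum (take m os) → at (blocks j os) i < j + m
blocks-< j (o ∷ os) (suc m) i i<sum = subst (at (blocks j (o ∷ os)) i <_) (sym (ℕ.+-suc j m)) (go o i i<sum)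
  where
  go : ∀ o i → i < o + sum (take m os) → at (replicate o j ++ blocks (suc j) os) i < suc j + m
  go zero    i       l       = blocks-< (suc j) os m i l
  go (suc o) zero    _       = s≤s (ℕ.m≤m+n j m)
  go (suc o) (suc i) (s≤s l) = go o i l

∑-at : ∀ (f : ℕ → ℕ) xs → ∑ (λ (i : Fin (length xs)) → f (at xs (toℕ i))) ≡ sumOf f xs
∑-at f []       = refl
∑-at f (x ∷ xs) = cong (f x +_) (∑-at f xs)

tabulate-at : ∀ xs → List.tabulate (λ (i : Fin (length xs)) → at xs (toℕ i)) ≡ xs
tabulate-at []       = refl
tabulate-at (x ∷ xs) = cong (x ∷_) (tabulate-at xs)

at-map-pred : ∀ {xs} → All (1 ≤_) xs → ∀ (i : Fin (length xs)) → at (map pred xs) (toℕ i) + 1 ≡ at xs (toℕ i)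
at-map-pred {suc x ∷ _} (_ ∷ _)   zero    = ℕ.+-comm x 1
at-map-pred             (_ ∷ all) (suc i) = at-map-pred all i

-- The greedy tree as a rooted tree

module _ (D : List ℕ) where

  open import Data.List.Membership.DecPropositional (×-≡-dec ℕ._≟_ ℕ._≟_) renaming (_∈?_ to _∈E?_)

  private
    Edge : ℕ → ℕ → Set
    Edge u v = (u , v) L.∈ greedyTreeEdges D

    edge? : ∀ (u v : Fin (length D)) → Dec (Edge (toℕ u) (toℕ v) ⊎ Edge (toℕ v) (toℕ u))
    edge? u v = ((toℕ u , toℕ v) ∈E? greedyTreeEdges D) ⊎-dec ((toℕ v , toℕ u) ∈E? greedyTreeEdges D)

  -- The Boolean disjunction in `greedyTree` is what `⊎-dec` computes, so `greedyTree D` is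
  -- `fromRel edge?` by definition.
  greedyTree⁺ : ∀ {u v} → Edge (toℕ u) (toℕ v) ⊎ Edge (toℕ v) (toℕ u) → Adj (greedyTree D) u v
  greedyTree⁺ = fromRel⁺ edge?

  greedyTree⁻ : ∀ {u v} → Adj (greedyTree D) u v → Edge (toℕ u) (toℕ v) ⊎ Edge (toℕ v) (toℕ u)
  greedyTree⁻ = fromRel⁻ edge?

module Greedy {d : ℕ} {ds : List ℕ} (real : Realizable d ds) where

  open Realizable real

  os ps : List ℕ
  os = childCounts d ds
  ps = blocks 0 os

  edges : greedyTreeEdges (d ∷ ds) ≡ numbered 1 ps
  edges = trans (greedyEdges-numbered [ (0 , d) ] 1 ds (Linked.tail sorted)
      (trans (cong (_+ sum (map pred ds)) length-start) total) (λ l → subst (0 <_) (sym length-start) (root-child l)))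
    (cong (λ xs → numbered 1 (xs ++ blocks 1 (map pred ds))) (++-identityʳ (replicate d 0)))
    where
    length-start : length (pending [ (0 , d) ]) ≡ d
    length-start = trans (cong length (++-identityʳ (replicate d 0))) (length-replicate d)

  length-ps : length ps ≡ length ds
  length-ps = trans (length-blocks 0 os) total

  toℕ<length : (i : Fin (length ds)) → toℕ i < length ps
  toℕ<length i = subst (toℕ i <_) (sym length-ps) (Fin.toℕ<n i)

  at-increasing : ∀ {i} → i < length ps → at ps i < suc i
  at-increasing = numbered-at {λ (p , c) → p < c} 1 ps
    (subst (All (λ (p , c) → p < c)) edges (greedyEdges-increasing [ (0 , d) ] 1 ds (s≤s z≤n ∷ [])))

  at<n : (i : Fin (length ds)) → at ps (toℕ i) < length (d ∷ ds)
  at<n i = ℕ.<-≤-trans (at-increasing (toℕ<length i)) (ℕ.m≤n⇒m≤1+n (Fin.toℕ<n i))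

  greedyParent : Fin (length (d ∷ ds)) → Fin (length (d ∷ ds))
  greedyParent zero    = zero
  greedyParent (suc i) = fromℕ< (at<n i)

  toℕ-parent : ∀ i → toℕ (greedyParent (suc i)) ≡ at ps (toℕ i)
  toℕ-parent i = Fin.toℕ-fromℕ< (at<n i)

  R : Rooting (length (d ∷ ds))
  R = record { root = zero ; parent = greedyParent ; rank = toℕ ; rank-parent = decreasing }
    where
    decreasing : ∀ {v} → v ≢ zero → toℕ (greedyParent v) < toℕ v
    decreasing {zero}  v≢0 = contradiction refl v≢0
    decreasing {suc i} _   = subst (_< suc (toℕ i)) (sym (toℕ-parent i)) (at-increasing (toℕ<length i))

  edge⇒child : ∀ {u v} → (toℕ u , toℕ v) L.∈ greedyTreeEdges (d ∷ ds) → Child R u v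
  edge⇒child {u} {v} m with ∈-numbered⁻ 1 ps (subst ((toℕ u , toℕ v) L.∈_) edges m)
  edge⇒child {u} {suc i} m | _ , refl , u≡ = (λ ()) , Fin.toℕ-injective (trans (toℕ-parent i) (sym u≡))

  child⇒edge : ∀ {u v} → Child R u v → (toℕ u , toℕ v) L.∈ greedyTreeEdges (d ∷ ds)
  child⇒edge {v = zero}  (v≢0 , _)  = contradiction refl v≢0
  child⇒edge {v = suc i} (_ , refl) = subst (λ p → (p , suc (toℕ i)) L.∈ greedyTreeEdges (d ∷ ds)) (sym (toℕ-parent i))
    (subst ((at ps (toℕ i) , suc (toℕ i)) L.∈_) (sym edges)
      (numbered-at {L._∈ numbered 1 ps} 1 ps (All.tabulate id) (toℕ<length i)))

  GR : IsRooting (greedyTree (d ∷ ds)) R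
  GR = record
    { adj⇒child = Sum.map edge⇒child edge⇒child ∘ greedyTree⁻ (d ∷ ds)
    ; child⇒adj = λ c → greedyTree⁺ (d ∷ ds) (inj₁ (child⇒edge c))
    ; adj-sym   = λ uv → greedyTree⁺ (d ∷ ds) (Sum.swap (greedyTree⁻ (d ∷ ds) uv))
    }

  greedy-outdegree : ∀ u → outdegree R u ≡ at os (toℕ u)
  greedy-outdegree u = begin
    ∑ (λ i → ind (child? R u (suc i))) ≡⟨ sum-cong-≗ (λ i → ind-cong (child? R u (suc i)) (at ps (toℕ i) ℕ.≟ toℕ u)
        (λ (_ , eq) → trans (sym (toℕ-parent i)) (cong toℕ eq)) (λ eq → (λ ()) , Fin.toℕ-injective (trans (toℕ-parent i) eq))) ⟩
    ∑ {length ds} (λ i → ind (at ps (toℕ i) ℕ.≟ toℕ u)) ≡⟨ cong (λ m → ∑ {m} (λ i → ind (at ps (toℕ i) ℕ.≟ toℕ u))) (sym length-ps) ⟩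
    ∑ {length ps} (λ i → ind (at ps (toℕ i) ℕ.≟ toℕ u)) ≡⟨ ∑-at (λ p → ind (p ℕ.≟ toℕ u)) ps ⟩
    sumOf (λ p → ind (p ℕ.≟ toℕ u)) ps ≡⟨ blocks-count 0 os (toℕ u) ⟩
    at os (toℕ u) ∎
    where open ≡-Reasoning

  greedy-degree : ∀ u → degree (greedyTree (d ∷ ds)) u ≡ at (d ∷ ds) (toℕ u)
  greedy-degree u = trans (degree-outdegree GR u) (trans (cong (_+ ind (¬? (u ≟ zero))) (greedy-outdegree u)) (restore u))
    where
    restore : ∀ u → at os (toℕ u) + ind (¬? (u ≟ zero)) ≡ at (d ∷ ds) (toℕ u)
    restore zero    = ℕ.+-identityʳ d
    restore (suc i) = at-map-pred positive i

  isTree : IsTree (greedyTree (d ∷ ds))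
  isTree = isRooting⇒IsTree GR

  hasDegreeSequence : HasDegreeSequence (greedyTree (d ∷ ds)) (d ∷ ds)
  hasDegreeSequence = sorted , ↭-reflexive (trans (map-tabulate id (degree (greedyTree (d ∷ ds))))
    (trans (tabulate-cong greedy-degree) (tabulate-at (d ∷ ds))))

  breadth-first : ∀ m {v} → v ≢ zero → toℕ v < Φ os m → toℕ (greedyParent v) < m
  breadth-first m {zero}  v≢0 _       = contradiction refl v≢0
  -- Vertex `suc i` takes its parent from position `i` of `ps`; the root accounts for the `suc` in
  -- `Φ`.
  breadth-first m {suc i} _   (s≤s l) = subst (_< m) (sym (toℕ-parent i)) (blocks-< 0 os m (toℕ i) l)

  truncated-sizes : ∀ j k → ∑ (λ v → size R v ⊓ j) ≤ k * j + Σ< (length (d ∷ ds)) (λ t → length (d ∷ ds) ∸ level os k t)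
  truncated-sizes = truncated-sizes-upper R os (≼⇒rank≤ R) breadth-first

-- Comparison of two trees

module _ {n : ℕ} (R R′ : Rooting n) (r : ℕ) (balanced : ∀ {v} → v ≢ root R → 2 * size R v ≤ n)
         (dominated : ∀ j → j ≤ n → ∑ (λ v → size R′ v ⊓ j) ≤ ∑ (λ v → size R v ⊓ j)) where

  open Cut n r

  private
    C = binom n (suc r)

    larger : Rooting n → ℕ → ℕ
    larger Q a = ∑ λ v → ind (a ℕ.<? size Q v)

    weighted : ∀ Q → Σ< n (λ a → δ a * larger Q a) ≡ ∑ (λ v → Σ< (size Q v) δ)
    weighted Q = begin
      Σ< n (λ a → δ a * larger Q a) ≡⟨ Σ<-cong n (λ a → *-distribˡ-sum (δ a) (λ v → ind (a ℕ.<? size Q v))) ⟩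
      Σ< n (λ a → ∑ λ v → δ a * ind (a ℕ.<? size Q v)) ≡⟨ Σ<-∑ n (λ a v → δ a * ind (a ℕ.<? size Q v)) ⟩
      ∑ (λ v → Σ< n (λ a → δ a * ind (a ℕ.<? size Q v))) ≡⟨ sum-cong-≗ (λ v → trans (Σ<-truncate n (size Q v) δ) (cong (flip Σ< δ) (ℕ.m≤n⇒m⊓n≡m (size≤ Q v)))) ⟩
      ∑ (λ v → Σ< (size Q v) δ) ∎
      where open ≡-Reasoning

    slopes : ∑ (λ v → Σ< (size R′ v) δ) ≤ ∑ (λ v → Σ< (size R v) δ)
    slopes = subst₂ _≤_ (weighted R′) (weighted R) (abel δ (larger R) (larger R′) δ-antitone n λ j j≤n →
      subst₂ _≤_ (sym (∑-levels (size R′) j)) (sym (∑-levels (size R) j)) (dominated j j≤n))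

    -- The root has size `n` and is exempt from balance. It brings in all slopes at once, the same
    -- surplus `Σ< n δ` in either tree, so the surplus cancels.
    baseline : (Q : Rooting n) → ∑ (λ v → C + ind (v ≟ root Q) * Σ< n δ) ≡ n * C + Σ< n δ
    baseline Q = trans (∑-distrib-+ (λ _ → C) (λ v → ind (v ≟ root Q) * Σ< n δ)) (cong₂ _+_ (∑-const n C) (∑-δ (root Q) (λ _ → Σ< n δ)))

    at-root : (Q : Rooting n) → h (size Q (root Q)) + Σ< (size Q (root Q)) δ ≡ C + 1 * Σ< n δ
    at-root Q = trans (cong (λ k → h k + Σ< k δ) (size-root Q)) (cong₂ _+_ h-n (sym (ℕ.*-identityˡ _)))

    upper : ∑ (λ v → h (size R v)) + ∑ (λ v → Σ< (size R v) δ) ≤ n * C + Σ< n δ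
    upper = subst₂ _≤_ (∑-distrib-+ (λ v → h (size R v)) _) (baseline R) (∑-mono λ v → pointwise v (v ≟ root R))
      where
      pointwise : ∀ v (v? : Dec (v ≡ root R)) → h (size R v) + Σ< (size R v) δ ≤ C + ind v? * Σ< n δ
      pointwise v (yes refl) = ℕ.≤-reflexive (at-root R)
      pointwise v (no v≢r)   = ℕ.≤-reflexive (trans (h-exact (size R v) (balanced v≢r)) (sym (ℕ.+-identityʳ C)))

    lower : n * C + Σ< n δ ≤ ∑ (λ v → h (size R′ v)) + ∑ (λ v → Σ< (size R′ v) δ)
    lower = subst₂ _≤_ (baseline R′) (∑-distrib-+ (λ v → h (size R′ v)) _) (∑-mono λ v → pointwise v (v ≟ root R′))
      where
      pointwise : ∀ v (v? : Dec (v ≡ root R′)) → C + ind v? * Σ< n δ ≤ h (size R′ v) + Σ< (size R′ v) δ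
      pointwise v (yes refl) = ℕ.≤-reflexive (sym (at-root R′))
      pointwise v (no v≢r)   = ℕ.≤-trans (ℕ.≤-reflexive (ℕ.+-identityʳ C)) (h-lower (size R′ v) (size≤ R′ v))

  ∑-h-mono : ∑ (λ v → h (size R v)) ≤ ∑ (λ v → h (size R′ v))
  ∑-h-mono = ℕ.+-cancelʳ-≤ (∑ (λ v → Σ< (size R v) δ)) _ _ (ℕ.≤-trans upper (ℕ.≤-trans lower (ℕ.+-monoʳ-≤ _ slopes)))

steinerWiener-mono : {T T′ : Digraph n} {R R′ : Rooting n} → IsTree T → IsRooting T R → IsTree T′ → IsRooting T′ R′ →
  (∀ {v} → v ≢ root R → 2 * size R v ≤ n) →
  (∀ j → j ≤ n → ∑ (λ v → size R′ v ⊓ j) ≤ ∑ (λ v → size R v ⊓ j)) →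
  ∀ r → steinerWiener (suc r) T′ ≤ steinerWiener (suc r) T
steinerWiener-mono {n} {T} {T′} {R} {R′} tree TR tree′ TR′ balanced dominated r = ℕ.+-cancelʳ-≤ (∑ λ v → Cut.h n r (size R′ v)) _ _ (begin
    steinerWiener (suc r) T′ + ∑ (λ v → Cut.h n r (size R′ v)) ≤⟨ steinerWiener-upper tree′ TR′ r ⟩
    n * binom n (suc r) ≤⟨ steinerWiener-lower tree TR r ⟩
    steinerWiener (suc r) T + ∑ (λ v → Cut.h n r (size R v)) ≤⟨ ℕ.+-monoʳ-≤ (steinerWiener (suc r) T) (∑-h-mono R R′ r balanced dominated) ⟩
    steinerWiener (suc r) T + ∑ (λ v → Cut.h n r (size R′ v)) ∎)
  where open ℕ.≤-Reasoning

module _ {d : ℕ} {ds : List ℕ} (real : Realizable d ds) where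

  open Greedy real

  greedy-dominated : (T : Digraph (length (d ∷ ds))) (Q : Rooting (length (d ∷ ds))) → IsRooting T Q → HasDegreeSequence T (d ∷ ds) →
    ∀ j → j ≤ length (d ∷ ds) → ∑ (λ v → size R v ⊓ j) ≤ ∑ (λ v → size Q v ⊓ j)
  -- The number of large subtrees of `Q` is the `k` for which the greedy bound is used.
  greedy-dominated T Q TQ seq j j≤n = ℕ.≤-trans (truncated-sizes j (proj₁ bound)) (proj₂ bound)
    where bound = truncated-sizes-lower {T = T} {R = Q} TQ seq j≤n

  greedy-minimal : n ≡ length (d ∷ ds) → (T : Digraph n) → IsTree T → HasDegreeSequence T (d ∷ ds) →
    ∀ r → steinerWiener (suc r) (greedyTree (d ∷ ds)) ≤ steinerWiener (suc r) T
  greedy-minimal refl T tree seq =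
    steinerWiener-mono {n = length (d ∷ ds)} {T = T} {T′ = greedyTree (d ∷ ds)} {R = centroid tree} {R′ = R} tree (centroid-isRooting tree) isTree GR (centroid-balanced tree)
      (greedy-dominated T (centroid tree) (centroid-isRooting tree) seq)

theorem2p22 : (D : List ℕ) → IsTreeDegreeSequence D → (r : ℕ) → r > 0 →
    (IsTree (greedyTree D) × HasDegreeSequence (greedyTree D) D) ×
    ((n : ℕ) (T : Digraph n) → IsTree T → HasDegreeSequence T D →
    steinerWiener r T ≥ steinerWiener r (greedyTree D))
theorem2p22 []       (n , T , tree , seq) _ _ = ⊥-elim (no-vertices (sequence-length {T = T} seq) (proj₁ (IsTreeOn.nonempty tree)))
  where
  no-vertices : n ≡ 0 → ¬ Fin n
  no-vertices refl ()
theorem2p22 (d ∷ ds) (n , T , tree , seq) (suc r) _ =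
  (Greedy.isTree real , Greedy.hasDegreeSequence real) , λ _ T′ → λ tree′ seq′ → greedy-minimal real (sequence-length {T = T′} seq′) T′ tree′ seq′ r
  where
  real : Realizable d ds
  real = realizable tree seq
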